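{- Let $M$ be a connected matroid of rank $2$ on the ground set $\{1,\ldots,n\}$. Suppose that $M$ has exactly $s$ hyperplanes, of sizes $a_1,\ldots,a_s$. Then $s\geq 3$ and \[ \operatorname{ehr}(\mathscr{P}(M),t)\ =\ \binom{2t+n-1}{n-1}-\sum_{i=1}^{s}P_{a_i,n}(t), \] where, for $1\leq a\leq n$, \[ P_{a,n}(t):=\sum_{k=1}^{a}\binom{t+n-k-1}{n-k}\binom{t+k-1}{k-1}. \]
   Context: For a matroid $M$ on $\{1,\ldots,n\}$ with set of bases $\mathscr{B}$, the matroid (base) polytope is $\mathscr{P}(M)=\operatorname{conv}\{e_B : B\in\mathscr{B}\}\subseteq\mathbb{R}^n$, where $e_B=\sum_{i\in B}e_i$. For a lattice polytope $\mathscr{P}\subseteq\mathbb{R}^n$, its Ehrhart polynomial $\operatorname{ehr}(\mathscr{P},t)$ is the polynomial in $t$ with $\operatorname{ehr}(\mathscr{P},t)=\#(t\mathscr{P}\cap\mathbb{Z}^n)$ for all integers $t\geq 0$. A hyperplane of a matroid $M$ is a flat of rank $\operatorname{rk}(M)-1$. A matroid is connected if it is not a direct sum of matroids on smaller ground sets. Binomial coefficients $\binom{t+c}{m}$ with $m\ge 0$ an integer are read as polynomials in $t$, namely $\frac{1}{m!}\prod_{i=0}^{m-1}(t+c-i)$. -}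

module Defs where

open import Level using (Level; 0ℓ)
open import Data.Bool.Base using (if_then_else_)
open import Data.Fin.Base using (Fin)
open import Data.Fin.Subset using (Subset; inside; outside; ⊥; ⊤; ⁅_⁆; _∈_; _∉_; _⊆_; _⊂_; _∩_; _∪_; _-_; ∣_∣)
open import Data.Integer.Base as ℤ using (ℤ)
open import Data.List.Base as List using (List; []; _∷_; _++_; upTo; filter)
open import Data.List.Extrema.Nat using (max)
open import Data.Nat.Base as ℕ using (ℕ; zero; suc; _!)
import Data.Nat.Properties as ℕₚ
open import Data.Product using (Σ-syntax; ∃; ∃₂; ∃-syntax; _×_; _,_)
open import Data.Rational.Base as ℚ using (ℚ; 0ℚ; 1ℚ; ½)
import Data.Rational.Properties as ℚₚ
open import Data.Rational.Solver using (module +-*-Solver)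
open import Data.Vec.Base as Vec using (Vec; lookup)
import Data.Vec.Functional as VF
open import Function.Base using (_∘_)
open import Function.Bundles using (_⇔_)
open import Function.Definitions using (Injective)
open import Relation.Binary.PropositionalEquality using (_≡_; refl; sym; cong; cong₂; subst; module ≡-Reasoning)
open import Relation.Nullary using (¬_)
open import Relation.Unary using (Pred; Decidable)

private
  variable
    ℓ ℓ′ : Level
    A : Set ℓ
    n : ℕ

-- "S has exactly k elements", with a chosen enumeration of them.
record Enumeration {A : Set ℓ} (S : Pred A ℓ′) (k : ℕ) : Set (ℓ Level.⊔ ℓ′) where
  field
    element   : Fin k → A
    injective : Injective _≡_ _≡_ element
    sound     : ∀ i → S (element i)
    complete  : ∀ {x} → S x → ∃[ i ] element i ≡ x

-- A matroid, given by its bases, whose ground set E is a subset of Fin n.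
-- Membership in the set of bases is required to be decidable, as it always
-- is classically.
record Matroid {n : ℕ} (E : Subset n) : Set₁ where
  field
    Base     : Pred (Subset n) 0ℓ
    base?    : Decidable Base
    base⊆E   : ∀ {B} → Base B → B ⊆ E
    nonempty : ∃ Base
    exchange : ∀ {B₁ B₂ x} → Base B₁ → Base B₂ → x ∈ B₁ → x ∉ B₂ →
               ∃[ y ] y ∈ B₂ × y ∉ B₁ × Base ((B₁ - x) ∪ ⁅ y ⁆)

allSubsets : ∀ n → List (Subset n)
allSubsets zero    = Vec.[] ∷ []
allSubsets (suc n) = List.map (outside Vec.∷_) (allSubsets n) ++ List.map (inside Vec.∷_) (allSubsets n)

module _ {E : Subset n} (M : Matroid E) where
  open Matroid M

  rank : Subset n → ℕ
  rank A = max 0 (List.map (λ B → ∣ A ∩ B ∣) (filter base? (allSubsets n)))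

  rk : ℕ
  rk = rank E

  IsFlat : Pred (Subset n) 0ℓ
  IsFlat F = F ⊆ E × (∀ {x} → x ∈ E → x ∉ F → rank F ℕ.< rank (F ∪ ⁅ x ⁆))

  IsHyperplane : Pred (Subset n) 0ℓ
  IsHyperplane H = IsFlat H × suc (rank H) ≡ rk

record IsDirectSum {E S T : Subset n} (M : Matroid E) (M₁ : Matroid S) (M₂ : Matroid T) : Set where
  open Matroid
  field
    union    : S ∪ T ≡ E
    disjoint : S ∩ T ≡ ⊥
    bases    : ∀ B → Base M B ⇔ (∃₂ λ B₁ B₂ → Base M₁ B₁ × Base M₂ B₂ × B ≡ B₁ ∪ B₂)

Connected : {E : Subset n} → Matroid E → Set₁
Connected {n} {E} M =
  ¬ (Σ[ S ∈ Subset n ] Σ[ T ∈ Subset n ] S ⊂ E × T ⊂ E ×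
     Σ[ M₁ ∈ Matroid S ] Σ[ M₂ ∈ Matroid T ] IsDirectSum M M₁ M₂)

-- Polynomials in t as lists of coefficients, constant term first.
ℚ[t] : Set
ℚ[t] = List ℚ

infixl 6 _+ᵖ_ _-ᵖ_
infixl 7 _*ᵖ_
infixr 8 _·ᵖ_

_+ᵖ_ : ℚ[t] → ℚ[t] → ℚ[t]
[]      +ᵖ q       = q
(a ∷ p) +ᵖ []      = a ∷ p
(a ∷ p) +ᵖ (b ∷ q) = a ℚ.+ b ∷ p +ᵖ q

_·ᵖ_ : ℚ → ℚ[t] → ℚ[t]
a ·ᵖ p = List.map (a ℚ.*_) p

_-ᵖ_ : ℚ[t] → ℚ[t] → ℚ[t]
p -ᵖ q = p +ᵖ (ℚ.- 1ℚ) ·ᵖ q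

_*ᵖ_ : ℚ[t] → ℚ[t] → ℚ[t]
[]      *ᵖ q = []
(a ∷ p) *ᵖ q = a ·ᵖ q +ᵖ (0ℚ ∷ p *ᵖ q)

eval : ℚ[t] → ℚ → ℚ
eval p x = List.foldr (λ a r → a ℚ.+ x ℚ.* r) 0ℚ p

ℤ→ℚ : ℤ → ℚ
ℤ→ℚ z = z ℚ./ 1

ℕ→ℚ : ℕ → ℚ
ℕ→ℚ k = ℤ→ℚ (ℤ.+ k)

infix 7 _t+_

-- α t+ c is the linear polynomial αt + c.
_t+_ : ℤ → ℤ → ℚ[t]
α t+ c = ℤ→ℚ c ∷ ℤ→ℚ α ∷ []

1/_! : ℕ → ℚ
1/ m ! = (ℤ.+ 1 ℚ./ (m !)) {{m ℕₚ.!≢0}}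

binom : ℚ[t] → ℕ → ℚ[t]
binom p m = 1/ m ! ·ᵖ List.foldr _*ᵖ_ (1ℚ ∷ []) (List.map (λ i → p -ᵖ (ℕ→ℚ i ∷ [])) (upTo m))

-- The sum over k = 1, …, a is indexed by k = suc j with j < a.  For a ≤ n the
-- truncated subtraction n ∸ k is the true one; the constant term n - k - 1
-- can be -1, hence is taken in ℤ.
P : (a n : ℕ) → ℚ[t]
P a n = List.foldr _+ᵖ_ [] (List.map (term ∘ suc) (upTo a))
  where
  term : ℕ → ℚ[t]
  term k = binom (ℤ.+ 1 t+ (ℤ.+ n ℤ.- ℤ.+ k ℤ.- ℤ.+ 1)) (n ℕ.∸ k)
        *ᵖ binom (ℤ.+ 1 t+ (ℤ.+ k ℤ.- ℤ.+ 1)) (k ℕ.∸ 1)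

-- Real numbers are Cauchy sequences of rationals, considered up to _≈_.
IsCauchy : Pred (ℕ → ℚ) 0ℓ
IsCauchy x = ∀ ε → 0ℚ ℚ.< ε → ∃[ N ] (∀ {i j} → N ℕ.≤ i → N ℕ.≤ j → ℚ.∣ x i ℚ.- x j ∣ ℚ.≤ ε)

record ℝ : Set where
  constructor mkℝ
  field
    seq    : ℕ → ℚ
    cauchy : IsCauchy seq

open ℝ

infix 4 _≈_ _≤_
infixl 6 _+_
infixl 7 _*_

_≈_ : ℝ → ℝ → Set
x ≈ y = ∀ ε → 0ℚ ℚ.< ε → ∃[ N ] (∀ {i} → N ℕ.≤ i → ℚ.∣ seq x i ℚ.- seq y i ∣ ℚ.≤ ε)

_≤_ : ℝ → ℝ → Set
x ≤ y = ∀ ε → 0ℚ ℚ.< ε → ∃[ N ] (∀ {i} → N ℕ.≤ i → seq x i ℚ.≤ seq y i ℚ.+ ε)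

ℚ→ℝ : ℚ → ℝ
ℚ→ℝ q = mkℝ (λ _ → q) λ ε 0<ε → 0 , λ _ _ →
  subst (λ d → ℚ.∣ d ∣ ℚ.≤ ε) (sym (ℚₚ.+-inverseʳ q)) (ℚₚ.<⇒≤ 0<ε)

ℤ→ℝ : ℤ → ℝ
ℤ→ℝ = ℚ→ℝ ∘ ℤ→ℚ

0ℝ 1ℝ : ℝ
0ℝ = ℚ→ℝ 0ℚ
1ℝ = ℚ→ℝ 1ℚ

private
  ½ε+½ε : ∀ ε → ½ ℚ.* ε ℚ.+ ½ ℚ.* ε ≡ ε
  ½ε+½ε ε = begin
    ½ ℚ.* ε ℚ.+ ½ ℚ.* ε ≡⟨ ℚₚ.*-distribʳ-+ ε ½ ½ ⟨
    1ℚ ℚ.* ε            ≡⟨ ℚₚ.*-identityˡ ε ⟩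
    ε                   ∎
    where open ≡-Reasoning

  0<½ε : ∀ {ε} → 0ℚ ℚ.< ε → 0ℚ ℚ.< ½ ℚ.* ε
  0<½ε {ε} 0<ε = ℚₚ.*-monoʳ-<-pos ½ 0<ε

  +-cauchy : ∀ {x y} → IsCauchy x → IsCauchy y → IsCauchy (λ i → x i ℚ.+ y i)
  +-cauchy {x} {y} cx cy ε 0<ε =
    let N₁ , h₁ = cx (½ ℚ.* ε) (0<½ε 0<ε)
        N₂ , h₂ = cy (½ ℚ.* ε) (0<½ε 0<ε)
    in N₁ ℕ.⊔ N₂ , λ {i} {j} N≤i N≤j → begin
      ℚ.∣ (x i ℚ.+ y i) ℚ.- (x j ℚ.+ y j) ∣
        ≡⟨ cong ℚ.∣_∣ (solve 4 (λ a b c d → (a :+ b) :- (c :+ d) := (a :- c) :+ (b :- d)) refl (x i) (y i) (x j) (y j)) ⟩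
      ℚ.∣ (x i ℚ.- x j) ℚ.+ (y i ℚ.- y j) ∣
        ≤⟨ ℚₚ.∣p+q∣≤∣p∣+∣q∣ (x i ℚ.- x j) (y i ℚ.- y j) ⟩
      ℚ.∣ x i ℚ.- x j ∣ ℚ.+ ℚ.∣ y i ℚ.- y j ∣
        ≤⟨ ℚₚ.+-mono-≤ (h₁ (ℕₚ.m⊔n≤o⇒m≤o N₁ N₂ N≤i) (ℕₚ.m⊔n≤o⇒m≤o N₁ N₂ N≤j))
                       (h₂ (ℕₚ.m⊔n≤o⇒n≤o N₁ N₂ N≤i) (ℕₚ.m⊔n≤o⇒n≤o N₁ N₂ N≤j)) ⟩
      ½ ℚ.* ε ℚ.+ ½ ℚ.* ε ≡⟨ ½ε+½ε ε ⟩
      ε ∎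
    where
    open ℚₚ.≤-Reasoning
    open +-*-Solver

cauchy⇒bounded : ∀ {x} → IsCauchy x →
  ∃₂ λ N K → 0ℚ ℚ.< K × (∀ {i} → N ℕ.≤ i → ℚ.∣ x i ∣ ℚ.≤ K)
cauchy⇒bounded {x} cx =
  let N , h = cx 1ℚ 0<1
  in N , 1ℚ ℚ.+ ℚ.∣ x N ∣ , ℚₚ.+-mono-<-≤ 0<1 (ℚₚ.0≤∣p∣ (x N)) , λ {i} N≤i → begin
    ℚ.∣ x i ∣                           ≡⟨ cong ℚ.∣_∣ (solve 2 (λ a b → a := (a :- b) :+ b) refl (x i) (x N)) ⟩
    ℚ.∣ (x i ℚ.- x N) ℚ.+ x N ∣         ≤⟨ ℚₚ.∣p+q∣≤∣p∣+∣q∣ (x i ℚ.- x N) (x N) ⟩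
    ℚ.∣ x i ℚ.- x N ∣ ℚ.+ ℚ.∣ x N ∣     ≤⟨ ℚₚ.+-monoˡ-≤ ℚ.∣ x N ∣ (h N≤i ℕₚ.≤-refl) ⟩
    1ℚ ℚ.+ ℚ.∣ x N ∣ ∎
  where
  open ℚₚ.≤-Reasoning
  open +-*-Solver
  0<1 : 0ℚ ℚ.< 1ℚ
  0<1 = ℚₚ.positive⁻¹ 1ℚ

private
  shrink : ∀ {K η} → 0ℚ ℚ.< K → 0ℚ ℚ.< η → ∃[ δ ] 0ℚ ℚ.< δ × K ℚ.* δ ≡ η
  shrink {K} {η} 0<K 0<η = δ , 0<δ , eq
    where
    instance
      K>0 : ℚ.Positive K
      K>0 = ℚ.positive 0<K
      K≢0 : ℚ.NonZero K
      K≢0 = ℚₚ.pos⇒nonZero K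
      η>0 : ℚ.Positive η
      η>0 = ℚ.positive 0<η
      1/K>0 : ℚ.Positive (ℚ.1/ K)
      1/K>0 = ℚₚ.1/pos⇒pos K
    δ : ℚ
    δ = (ℚ.1/ K) ℚ.* η
    0<δ : 0ℚ ℚ.< δ
    0<δ = ℚₚ.positive⁻¹ δ {{ℚₚ.pos*pos⇒pos (ℚ.1/ K) η}}
    eq : K ℚ.* δ ≡ η
    eq = begin
      K ℚ.* ((ℚ.1/ K) ℚ.* η)  ≡⟨ ℚₚ.*-assoc K (ℚ.1/ K) η ⟨
      K ℚ.* (ℚ.1/ K) ℚ.* η    ≡⟨ cong (ℚ._* η) (ℚₚ.*-inverseʳ K) ⟩
      1ℚ ℚ.* η                ≡⟨ ℚₚ.*-identityˡ η ⟩
      η                       ∎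
      where open ≡-Reasoning

  ∣*∣-mono : ∀ {K δ} p q → 0ℚ ℚ.< K → ℚ.∣ p ∣ ℚ.≤ K → ℚ.∣ q ∣ ℚ.≤ δ → ℚ.∣ p ℚ.* q ∣ ℚ.≤ K ℚ.* δ
  ∣*∣-mono {K} {δ} p q 0<K p≤K q≤δ = begin
    ℚ.∣ p ℚ.* q ∣          ≡⟨ ℚₚ.∣p*q∣≡∣p∣*∣q∣ p q ⟩
    ℚ.∣ p ∣ ℚ.* ℚ.∣ q ∣    ≤⟨ ℚₚ.*-monoʳ-≤-nonNeg ℚ.∣ q ∣ {{ℚ.nonNegative (ℚₚ.0≤∣p∣ q)}} p≤K ⟩
    K ℚ.* ℚ.∣ q ∣          ≤⟨ ℚₚ.*-monoˡ-≤-nonNeg K {{ℚ.nonNegative (ℚₚ.<⇒≤ 0<K)}} q≤δ ⟩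
    K ℚ.* δ                ∎
    where open ℚₚ.≤-Reasoning

  *-cauchy : ∀ {x y} → IsCauchy x → IsCauchy y → IsCauchy (λ i → x i ℚ.* y i)
  *-cauchy {x} {y} cx cy ε 0<ε =
    let Nx , K , 0<K , bx = cauchy⇒bounded cx
        Ny , L , 0<L , by = cauchy⇒bounded cy
        δ₁ , 0<δ₁ , Kδ₁   = shrink 0<K (0<½ε 0<ε)
        δ₂ , 0<δ₂ , Lδ₂   = shrink 0<L (0<½ε 0<ε)
        N₁ , h₁           = cy δ₁ 0<δ₁
        N₂ , h₂           = cx δ₂ 0<δ₂
        N                 = (Nx ℕ.⊔ Ny) ℕ.⊔ (N₁ ℕ.⊔ N₂)
        ≥x : ∀ {i} → N ℕ.≤ i → Nx ℕ.≤ i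
        ≥x p = ℕₚ.m⊔n≤o⇒m≤o Nx Ny (ℕₚ.m⊔n≤o⇒m≤o (Nx ℕ.⊔ Ny) (N₁ ℕ.⊔ N₂) p)
        ≥y : ∀ {i} → N ℕ.≤ i → Ny ℕ.≤ i
        ≥y p = ℕₚ.m⊔n≤o⇒n≤o Nx Ny (ℕₚ.m⊔n≤o⇒m≤o (Nx ℕ.⊔ Ny) (N₁ ℕ.⊔ N₂) p)
        ≥₁ : ∀ {i} → N ℕ.≤ i → N₁ ℕ.≤ i
        ≥₁ p = ℕₚ.m⊔n≤o⇒m≤o N₁ N₂ (ℕₚ.m⊔n≤o⇒n≤o (Nx ℕ.⊔ Ny) (N₁ ℕ.⊔ N₂) p)
        ≥₂ : ∀ {i} → N ℕ.≤ i → N₂ ℕ.≤ i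
        ≥₂ p = ℕₚ.m⊔n≤o⇒n≤o N₁ N₂ (ℕₚ.m⊔n≤o⇒n≤o (Nx ℕ.⊔ Ny) (N₁ ℕ.⊔ N₂) p)
    in N , λ {i} {j} N≤i N≤j → begin
      ℚ.∣ x i ℚ.* y i ℚ.- x j ℚ.* y j ∣
        ≡⟨ cong ℚ.∣_∣ (solve 4 (λ a b c d → a :* b :- c :* d := a :* (b :- d) :+ d :* (a :- c)) refl (x i) (y i) (x j) (y j)) ⟩
      ℚ.∣ x i ℚ.* (y i ℚ.- y j) ℚ.+ y j ℚ.* (x i ℚ.- x j) ∣
        ≤⟨ ℚₚ.∣p+q∣≤∣p∣+∣q∣ (x i ℚ.* (y i ℚ.- y j)) (y j ℚ.* (x i ℚ.- x j)) ⟩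
      ℚ.∣ x i ℚ.* (y i ℚ.- y j) ∣ ℚ.+ ℚ.∣ y j ℚ.* (x i ℚ.- x j) ∣
        ≤⟨ ℚₚ.+-mono-≤ (∣*∣-mono (x i) (y i ℚ.- y j) 0<K (bx (≥x N≤i)) (h₁ (≥₁ N≤i) (≥₁ N≤j)))
                       (∣*∣-mono (y j) (x i ℚ.- x j) 0<L (by (≥y N≤j)) (h₂ (≥₂ N≤i) (≥₂ N≤j))) ⟩
      K ℚ.* δ₁ ℚ.+ L ℚ.* δ₂ ≡⟨ cong₂ ℚ._+_ Kδ₁ Lδ₂ ⟩
      ½ ℚ.* ε ℚ.+ ½ ℚ.* ε   ≡⟨ ½ε+½ε ε ⟩
      ε ∎
    where
    open ℚₚ.≤-Reasoning
    open +-*-Solver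

_+_ : ℝ → ℝ → ℝ
x + y = mkℝ (λ i → seq x i ℚ.+ seq y i) (+-cauchy {seq x} {seq y} (cauchy x) (cauchy y))

_*_ : ℝ → ℝ → ℝ
x * y = mkℝ (λ i → seq x i ℚ.* seq y i) (*-cauchy {seq x} {seq y} (cauchy x) (cauchy y))

∑ : ∀ {m} → (Fin m → ℝ) → ℝ
∑ = VF.foldr _+_ 0ℝ

ℝ^ : ℕ → Set
ℝ^ n = Fin n → ℝ

infix 4 _≋_

_≋_ : ℝ^ n → ℝ^ n → Set
x ≋ y = ∀ i → x i ≈ y i

conv : Pred (ℝ^ n) 0ℓ → Pred (ℝ^ n) 0ℓ
conv {n} S x =
  Σ[ m ∈ ℕ ] Σ[ p ∈ (Fin m → ℝ^ n) ] Σ[ c ∈ (Fin m → ℝ) ]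
    (∀ j → S (p j)) × (∀ j → 0ℝ ≤ c j) × ∑ c ≈ 1ℝ × x ≋ (λ i → ∑ (λ j → c j * p j i))

dilate : ℕ → Pred (ℝ^ n) 0ℓ → Pred (ℝ^ n) 0ℓ
dilate {n} t S x = Σ[ y ∈ ℝ^ n ] S y × x ≋ (λ i → ℤ→ℝ (ℤ.+ t) * y i)

LatticePoint : Pred (ℝ^ n) 0ℓ → Pred (Vec ℤ n) 0ℓ
LatticePoint S z = S (λ i → ℤ→ℝ (lookup z i))

-- q is the Ehrhart polynomial of S.  A polynomial is determined by its values
-- at the natural numbers, so q is unique (up to trailing zero coefficients).
IsEhrhartPolynomial : Pred (ℝ^ n) 0ℓ → ℚ[t] → Set
IsEhrhartPolynomial S q =
  ∀ (t : ℕ) → ∃[ k ] Enumeration (LatticePoint (dilate t S)) k × eval q (ℕ→ℚ t) ≡ ℕ→ℚ k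

e : Subset n → ℝ^ n
e B i = if lookup B i then 1ℝ else 0ℝ

matroidPolytope : {E : Subset n} → Matroid E → Pred (ℝ^ n) 0ℓ
matroidPolytope M = conv (λ x → ∃[ B ] Matroid.Base M B × x ≋ e B)

{-# OPTIONS --safe #-}
module Submission where

-- In a loopless matroid of rank 2 the hyperplanes are the parallel classes, and
-- the bases are the pairs of elements from distinct classes.  Connectedness
-- excludes loops, and it excludes two classes only, as M would be the sum of
-- two matroids of rank 1.
--
-- The lattice points of tP(M) are the z ≥ 0 with |z| = 2t and z(H) ≤ t for every
-- class H: each such z is a sum of t bases, obtained one at a time by removing
-- an element from each of two heaviest classes.  As |z| = 2t, at most one class
-- can violate z(H) ≤ t, so the points are counted by subtracting, for every H,
-- the number of z with z(H) > t.  List the elements of H first and let k be the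
-- first position where the partial sums of z exceed t.  The first k - 1 entries
-- have sum at most t, which leaves C(t+k-1,k-1) choices for them, and what
-- exceeds t + 1 is a composition of t - 1 into n - k + 1 parts, which leaves
-- C(t+n-k-1,n-k) choices.  Algebraically, this is a repeated summation by parts.

-- The polytope is defined over Cauchy reals: a point comes with coefficients that are nonnegative
-- only up to every positive error, and with vertices known only up to convergence. A lattice point,
-- however, is a constant sequence. An inequality that holds at all bases can therefore be carried
-- through the limit and read off again between rationals, then between integers. Three families of
-- inequalities suffice: the total, the single coordinates and the hyperplanes. The converse
-- inclusion stays within the rationals, since a sum of t bases is t times an average with
-- coefficients 1/t.
--
-- The polynomial identity is tested at natural t, and t = 0 stands apart: the count by first
-- passage past t presupposes t ≥ 1. At 0 the sum for a vanishes because a < n, so the proof has to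
-- know that every hyperplane is proper.

module Convergence where
  open import Algebra.Bundles using (CommutativeRing)
  import Algebra.Properties.Semiring.Sum as SemiringSum
  open import Defs using (ℝ; IsCauchy; cauchy⇒bounded; ∑)
  open ℝ using (seq)
  open import Data.Fin.Base using (Fin; zero; suc)
  open import Data.Nat.Base as ℕ using (ℕ; zero; suc)
  import Data.Nat.Properties as ℕₚ
  open import Data.Product using (_×_; _,_; ∃-syntax)
  open import Data.Rational.Base
  open import Data.Rational.Properties
  open import Data.Rational.Solver using (module +-*-Solver)
  open import Data.Sum.Base using (inj₁; inj₂)
  open import Function.Base using (_∘_; const)
  open import Relation.Binary.PropositionalEquality

  open SemiringSum (CommutativeRing.semiring +-*-commutativeRing) public
    using (∑-comm; *-distribˡ-sum) renaming (sum to sumℚ; sum-cong-≗ to sumℚ-cong)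

  -- Limits and inequalities of rational sequences

  infix 4 _∼_ _≲_

  -- Stated for bare sequences, because the intermediate sums and products are not packaged as
  -- reals. The record makes `x` and `y` inferable, whereas `_≈_` unfolds to a function type.
  record _∼_ (x y : ℕ → ℚ) : Set where
    constructor close
    field
      tends : ∀ ε → 0ℚ < ε → ∃[ N ] (∀ {i} → N ℕ.≤ i → ∣ x i - y i ∣ ≤ ε)

  record _≲_ (x y : ℕ → ℚ) : Set where
    constructor below
    field
      bounds : ∀ ε → 0ℚ < ε → ∃[ N ] (∀ {i} → N ℕ.≤ i → x i ≤ y i + ε)

  open _∼_
  open _≲_

  abstract
    divide : ∀ {K η} → 0ℚ < K → 0ℚ < η → ∃[ δ ] 0ℚ < δ × K * δ ≡ η
    divide {K} {η} 0<K 0<η = δ , positive⁻¹ δ {{pos*pos⇒pos (1/ K) η}} , (begin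
      K * (1/ K * η) ≡⟨ *-assoc K (1/ K) η ⟨
      K * 1/ K * η   ≡⟨ cong (_* η) (*-inverseʳ K) ⟩
      1ℚ * η         ≡⟨ *-identityˡ η ⟩
      η              ∎)
      where
      open ≡-Reasoning
      instance
        K>0 : Positive K
        K>0 = positive 0<K
        η>0 : Positive η
        η>0 = positive 0<η
        K≢0 : NonZero K
        K≢0 = pos⇒nonZero K
        1/K>0 : Positive (1/ K)
        1/K>0 = 1/pos⇒pos K
      δ : ℚ
      δ = 1/ K * η

    halve : ∀ {ε} → 0ℚ < ε → ∃[ δ ] 0ℚ < δ × δ + δ ≡ ε
    halve {ε} 0<ε with δ , 0<δ , eq ← divide {1ℚ + 1ℚ} (positive⁻¹ (1ℚ + 1ℚ)) 0<ε =
      δ , 0<δ , trans (sym (trans (*-distribʳ-+ δ 1ℚ 1ℚ) (cong₂ _+_ (*-identityˡ δ) (*-identityˡ δ)))) eq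

  ∣x-x∣≤ε : ∀ {x y ε} → x ≡ y → 0ℚ < ε → ∣ x - y ∣ ≤ ε
  ∣x-x∣≤ε {x} {ε = ε} refl 0<ε = subst (λ d → ∣ d ∣ ≤ ε) (sym (+-inverseʳ x)) (<⇒≤ 0<ε)

  0<1+p : ∀ {p} → 0ℚ ≤ p → 0ℚ < 1ℚ + p
  0<1+p 0≤p = +-mono-<-≤ (positive⁻¹ 1ℚ) 0≤p

  -- Reduces an inequality to a nonnegative slack `d` and a ring identity for the solver.
  ≤-byDifference : ∀ {x y} d → 0ℚ ≤ d → x + d ≡ y → x ≤ y
  ≤-byDifference {x} d 0≤d refl = subst (_≤ x + d) (+-identityʳ x) (+-monoʳ-≤ x 0≤d)

  0≤p*q : ∀ {p q} → 0ℚ ≤ p → 0ℚ ≤ q → 0ℚ ≤ p * q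
  0≤p*q {p} {q} 0≤p 0≤q = subst (_≤ p * q) (*-zeroˡ q) (*-monoʳ-≤-nonNeg q {{nonNegative 0≤q}} 0≤p)

  p≤q⇒0≤q-p : ∀ {p q} → p ≤ q → 0ℚ ≤ q - p
  p≤q⇒0≤q-p {p} {q} p≤q = subst (_≤ q - p) (+-inverseʳ p) (+-monoˡ-≤ (- p) p≤q)

  0≤p-q⇒q≤p : ∀ {p q} → 0ℚ ≤ p - q → q ≤ p
  0≤p-q⇒q≤p {p} {q} h = ≤-byDifference (p - q) h (solve 2 (λ p q → q :+ (p :- q) := p) refl p q)
    where open +-*-Solver

  module _ where
    open +-*-Solver

    ≗⇒∼ : ∀ {x y} → (∀ i → x i ≡ y i) → x ∼ y
    ≗⇒∼ x≗y = close λ ε 0<ε → 0 , λ {i} _ → ∣x-x∣≤ε (x≗y i) 0<ε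

    ∼-sym : ∀ {x y} → x ∼ y → y ∼ x
    tends (∼-sym {x} {y} x∼y) ε 0<ε with N , h ← tends x∼y ε 0<ε =
      N , λ {i} N≤i → subst (_≤ ε) (∣p-q∣≡∣q-p∣ (x i) (y i)) (h N≤i)
      where
      ∣p-q∣≡∣q-p∣ : ∀ p q → ∣ p - q ∣ ≡ ∣ q - p ∣
      ∣p-q∣≡∣q-p∣ p q = trans (sym (∣-p∣≡∣p∣ (p - q))) (cong ∣_∣ (solve 2 (λ p q → :- (p :- q) := q :- p) refl p q))

    ∼-trans : ∀ {x y z} → x ∼ y → y ∼ z → x ∼ z
    tends (∼-trans {x} {y} {z} x∼y y∼z) ε 0<ε with δ , 0<δ , refl ← halve 0<ε
      with N , h ← tends x∼y δ 0<δ | N′ , h′ ← tends y∼z δ 0<δ =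
      N ℕ.⊔ N′ , λ {i} N≤i → ≤-trans
        (≤-trans (≤-reflexive (cong ∣_∣ (solve 3 (λ x y z → x :- z := (x :- y) :+ (y :- z)) refl (x i) (y i) (z i))))
                 (∣p+q∣≤∣p∣+∣q∣ (x i - y i) (y i - z i)))
        (+-mono-≤ (h (ℕₚ.m⊔n≤o⇒m≤o N N′ N≤i)) (h′ (ℕₚ.m⊔n≤o⇒n≤o N N′ N≤i)))

    ∼-+-cong : ∀ {x y x′ y′} → x ∼ y → x′ ∼ y′ → (λ i → x i + x′ i) ∼ (λ i → y i + y′ i)
    tends (∼-+-cong {x} {y} {x′} {y′} x∼y x∼y′) ε 0<ε with δ , 0<δ , refl ← halve 0<ε
      with N , h ← tends x∼y δ 0<δ | N′ , h′ ← tends x∼y′ δ 0<δ =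
      N ℕ.⊔ N′ , λ {i} N≤i → ≤-trans
        (≤-trans (≤-reflexive (cong ∣_∣ (solve 4 (λ a b c d → (a :+ b) :- (c :+ d) := (a :- c) :+ (b :- d)) refl (x i) (x′ i) (y i) (y′ i))))
                 (∣p+q∣≤∣p∣+∣q∣ (x i - y i) (x′ i - y′ i)))
        (+-mono-≤ (h (ℕₚ.m⊔n≤o⇒m≤o N N′ N≤i)) (h′ (ℕₚ.m⊔n≤o⇒n≤o N N′ N≤i)))

    ∼-sum : ∀ {m} {x y : Fin m → ℕ → ℚ} → (∀ j → x j ∼ y j) → (λ i → sumℚ (λ j → x j i)) ∼ (λ i → sumℚ (λ j → y j i))
    ∼-sum {zero}  _   = ≗⇒∼ (λ _ → refl)
    ∼-sum {suc m} x∼y = ∼-+-cong (x∼y zero) (∼-sum (x∼y ∘ suc))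

    -- A Cauchy sequence is eventually bounded by some `K`, so closeness of `x` and `y` within ε / K
    -- is enough. This puts real coefficients in front of points that are known only up to `_∼_`.
    ∼-*-congˡ : ∀ c {x y} → IsCauchy c → x ∼ y → (λ i → c i * x i) ∼ (λ i → c i * y i)
    ∼-*-congˡ c {x} {y} c-cauchy x∼y =
      let M , K , 0<K , ∣c∣≤K = cauchy⇒bounded c-cauchy in bounded M 0<K ∣c∣≤K
      where
      bounded : ∀ M {K} → 0ℚ < K → (∀ {i} → M ℕ.≤ i → ∣ c i ∣ ≤ K) → (λ i → c i * x i) ∼ (λ i → c i * y i)
      tends (bounded M {K} 0<K ∣c∣≤K) ε 0<ε with δ , 0<δ , refl ← divide 0<K 0<ε with N , h ← tends x∼y δ 0<δ =
        M ℕ.⊔ N , λ {i} M≤i → ≤-trans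
          (≤-reflexive (trans (cong ∣_∣ (solve 3 (λ c x y → c :* x :- c :* y := c :* (x :- y)) refl (c i) (x i) (y i)))
                              (∣p*q∣≡∣p∣*∣q∣ (c i) (x i - y i))))
          (≤-trans (*-monoʳ-≤-nonNeg ∣ x i - y i ∣ {{nonNegative (0≤∣p∣ (x i - y i))}} (∣c∣≤K (ℕₚ.m⊔n≤o⇒m≤o M N M≤i)))
                   (*-monoˡ-≤-nonNeg K {{nonNegative (<⇒≤ 0<K)}} (h (ℕₚ.m⊔n≤o⇒n≤o M N M≤i))))

    const-cauchy : ∀ w → IsCauchy (const w)
    const-cauchy w ε 0<ε = 0 , λ _ _ → ∣x-x∣≤ε {w} refl 0<ε

    ∼-*-const : ∀ w {x y} → x ∼ y → (λ i → w * x i) ∼ (λ i → w * y i)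
    ∼-*-const w = ∼-*-congˡ (const w) (const-cauchy w)

    ∼⇒≲ : ∀ {x y} → x ∼ y → x ≲ y
    bounds (∼⇒≲ {x} {y} x∼y) ε 0<ε with N , h ← tends x∼y ε 0<ε =
      N , λ {i} N≤i → ≤-trans (≤-reflexive (solve 2 (λ x y → x := y :+ (x :- y)) refl (x i) (y i)))
                              (+-monoʳ-≤ (y i) (≤-trans (p≤∣p∣ (x i - y i)) (h N≤i)))
      where
      p≤∣p∣ : ∀ p → p ≤ ∣ p ∣
      p≤∣p∣ p with ≤-total 0ℚ p
      ... | inj₁ 0≤p = ≤-reflexive (sym (0≤p⇒∣p∣≡p 0≤p))
      ... | inj₂ p≤0 = ≤-trans p≤0 (0≤∣p∣ p)

    ≲-trans : ∀ {x y z} → x ≲ y → y ≲ z → x ≲ z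
    bounds (≲-trans {x} {y} {z} x≲y y≲z) ε 0<ε with δ , 0<δ , refl ← halve 0<ε
      with N , h ← bounds x≲y δ 0<δ | N′ , h′ ← bounds y≲z δ 0<δ =
      N ℕ.⊔ N′ , λ {i} N≤i → ≤-trans (h (ℕₚ.m⊔n≤o⇒m≤o N N′ N≤i))
        (≤-trans (+-monoˡ-≤ δ (h′ (ℕₚ.m⊔n≤o⇒n≤o N N′ N≤i))) (≤-reflexive (+-assoc (z i) δ δ)))

    ≲-+-mono : ∀ {x y x′ y′} → x ≲ y → x′ ≲ y′ → (λ i → x i + x′ i) ≲ (λ i → y i + y′ i)
    bounds (≲-+-mono {x} {y} {x′} {y′} x≲y x≲y′) ε 0<ε with δ , 0<δ , refl ← halve 0<ε
      with N , h ← bounds x≲y δ 0<δ | N′ , h′ ← bounds x≲y′ δ 0<δ =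
      N ℕ.⊔ N′ , λ {i} N≤i → ≤-trans (+-mono-≤ (h (ℕₚ.m⊔n≤o⇒m≤o N N′ N≤i)) (h′ (ℕₚ.m⊔n≤o⇒n≤o N N′ N≤i)))
        (≤-reflexive (solve 3 (λ a b d → (a :+ d) :+ (b :+ d) := (a :+ b) :+ (d :+ d)) refl (y i) (y′ i) δ))

    ≲-sum : ∀ {m} {x y : Fin m → ℕ → ℚ} → (∀ j → x j ≲ y j) → (λ i → sumℚ (λ j → x j i)) ≲ (λ i → sumℚ (λ j → y j i))
    ≲-sum {zero}  _   = ∼⇒≲ (≗⇒∼ (λ _ → refl))
    ≲-sum {suc m} x≲y = ≲-+-mono (x≲y zero) (≲-sum (x≲y ∘ suc))

    ≲-*-const : ∀ {t x y} → 0ℚ ≤ t → x ≲ y → (λ i → t * x i) ≲ (λ i → t * y i)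
    -- The divisor is 1 + t, since `t` itself may be 0.
    bounds (≲-*-const {t} {x} {y} 0≤t x≲y) ε 0<ε with δ , 0<δ , refl ← divide (0<1+p 0≤t) 0<ε with N , h ← bounds x≲y δ 0<δ =
      N , λ {i} N≤i → ≤-byDifference (t * ((y i + δ) - x i) + δ)
        (+-mono-≤ (0≤p*q 0≤t (p≤q⇒0≤q-p (h N≤i))) (<⇒≤ 0<δ))
        (solve 4 (λ t x y d → t :* x :+ (t :* ((y :+ d) :- x) :+ d) := t :* y :+ (con 1ℚ :+ t) :* d) refl t (x i) (y i) δ)

    -- Eventually `c i` is only known to be at least -δ, so multiplying by b - v may lose δ (b - v).
    -- The choice (1 + (b - v)) δ = ε absorbs this loss.
    ≲-*-nonNeg : ∀ {c v b} → const 0ℚ ≲ c → v ≤ b → (λ i → c i * v) ≲ (λ i → c i * b)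
    bounds (≲-*-nonNeg {c} {v} {b} 0≲c v≤b) ε 0<ε with δ , 0<δ , refl ← divide (0<1+p (p≤q⇒0≤q-p v≤b)) 0<ε with N , h ← bounds 0≲c δ 0<δ =
      N , λ {i} N≤i → ≤-byDifference ((c i + δ) * (b - v) + δ)
        (+-mono-≤ (0≤p*q (h N≤i) (p≤q⇒0≤q-p v≤b)) (<⇒≤ 0<δ))
        (solve 4 (λ c v b d → c :* v :+ ((c :+ d) :* (b :- v) :+ d) := c :* b :+ (con 1ℚ :+ (b :- v)) :* d) refl (c i) v b δ)

    -- The exit from limits: if q < p, an error of half the gap gives a contradiction.
    const-≲⁻ : ∀ {p q} → const p ≲ const q → p ≤ q
    const-≲⁻ {p} {q} h = ≮⇒≥ λ q<p →
      let δ , 0<δ , δ+δ≡ = halve (subst (_< p - q) (+-inverseʳ q) (+-monoˡ-< (- q) q<p))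
          N , p≤q+δ = bounds h δ 0<δ
      in <-irrefl refl (<-≤-trans (subst (_< δ + δ) (+-identityʳ δ) (+-monoʳ-< δ 0<δ))
          (≤-trans (≤-reflexive δ+δ≡) (≤-trans (+-monoˡ-≤ (- q) (p≤q+δ {N} ℕₚ.≤-refl))
            (≤-reflexive (solve 2 (λ q d → (q :+ d) :- q := d) refl q δ)))))

  sumℚ-interchange : ∀ {n m} (w : Fin n → ℚ) t (c : Fin m → ℚ) (u : Fin m → Fin n → ℚ) →
    sumℚ (λ i → w i * (t * sumℚ (λ j → c j * u j i))) ≡ t * sumℚ (λ j → c j * sumℚ (λ i → w i * u j i))
  sumℚ-interchange {n} {m} w t c u = begin
    sumℚ (λ i → w i * (t * sumℚ (λ j → c j * u j i)))
      ≡⟨ sumℚ-cong (λ i → trans (cong (w i *_) (*-distribˡ-sum t (λ j → c j * u j i)))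
           (*-distribˡ-sum (w i) (λ j → t * (c j * u j i)))) ⟩
    sumℚ (λ i → sumℚ (λ j → w i * (t * (c j * u j i))))
      ≡⟨ ∑-comm (λ i j → w i * (t * (c j * u j i))) ⟩
    sumℚ (λ j → sumℚ (λ i → w i * (t * (c j * u j i))))
      ≡⟨ sumℚ-cong (λ j → trans (sumℚ-cong (λ i → solve 4 (λ w t c u → w :* (t :* (c :* u)) := t :* (c :* (w :* u))) refl (w i) t (c j) (u j i)))
           (trans (sym (*-distribˡ-sum t (λ i → c j * (w i * u j i)))) (cong (t *_) (sym (*-distribˡ-sum (c j) (λ i → w i * u j i)))))) ⟩
    sumℚ (λ j → t * (c j * sumℚ (λ i → w i * u j i)))
      ≡⟨ *-distribˡ-sum t (λ j → c j * sumℚ (λ i → w i * u j i)) ⟨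
    t * sumℚ (λ j → c j * sumℚ (λ i → w i * u j i)) ∎
    where
    open ≡-Reasoning
    open +-*-Solver

  -- A bound for the functional `w` at the vertices passes to the dilated hull. The lattice point
  -- `z` and the vertices `u` are rational; the undilated point `y`, the coefficients `c` and the
  -- points `p` are sequences. Interchanging the sums bounds the functional by t times the sum of
  -- the `c j` times `b`, and the sum of the `c j` tends to 1.
  convexCombination-≤ : ∀ {n m} (w : Fin n → ℚ) {t b} → 0ℚ ≤ t →
    (z : Fin n → ℚ) (y : Fin n → ℕ → ℚ) (c : Fin m → ℕ → ℚ) (p : Fin m → Fin n → ℕ → ℚ) (u : Fin m → Fin n → ℚ) →
    (∀ i → const (z i) ∼ (λ k → t * y i k)) →
    (∀ i → y i ∼ (λ k → sumℚ (λ j → c j k * p j i k))) →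
    (∀ j i → p j i ∼ const (u j i)) →
    (∀ j → IsCauchy (c j)) → (∀ j → const 0ℚ ≲ c j) → (λ k → sumℚ (λ j → c j k)) ∼ const 1ℚ →
    (∀ j → sumℚ (λ i → w i * u j i) ≤ b) →
    sumℚ (λ i → w i * z i) ≤ t * b
  convexCombination-≤ w {t} {b} 0≤t z y c p u z∼ y∼ p∼ c-cauchy 0≲c ∑c∼1 w·u≤b = const-≲⁻
    (≲-trans (∼⇒≲ (∼-trans (∼-sum (λ i → ∼-*-const (w i) (∼-trans (z∼ i) (∼-*-const t (∼-trans (y∼ i)
        (∼-sum (λ j → ∼-*-congˡ (c j) (c-cauchy j) (p∼ j i)))))))) (≗⇒∼ (λ k → sumℚ-interchange w t (λ j → c j k) u))))
    (≲-trans (≲-*-const 0≤t (≲-sum (λ j → ≲-*-nonNeg (0≲c j) (w·u≤b j))))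
    (∼⇒≲ (∼-*-const t (∼-trans (≗⇒∼ (λ k → trans (sumℚ-cong (λ j → *-comm (c j k) b)) (sym (*-distribˡ-sum b (λ j → c j k)))))
      (∼-trans (∼-*-const b ∑c∼1) (≗⇒∼ (λ _ → *-identityʳ b))))))))

  seq-∑ : ∀ {m} (x : Fin m → ℝ) k → seq (∑ x) k ≡ sumℚ (λ j → seq (x j) k)
  seq-∑ {zero}  x k = refl
  seq-∑ {suc m} x k = cong (seq (x zero) k +_) (seq-∑ (x ∘ suc) k)

open Convergence

open import Defs hiding (_+_; _*_; _≤_)
open import Data.Bool.Base using (true; false; if_then_else_)
import Data.Bool.Properties as Boolₚ
open import Data.Empty using (⊥-elim)
open import Data.Fin using (Fin; zero; suc)
open import Data.Fin.Patterns using (0F; 1F; 2F)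
open import Data.Fin.Properties as Finₚ using (_≟_; any?; injective⇒≤; nonZeroIndex)
open import Data.Fin.Subset
open import Data.Fin.Subset.Properties
open import Data.List as List using (List; []; _∷_; _++_; foldr; map; allFin; filter; length; upTo)
open import Data.List.Extrema.Nat using (argmax; argmax-all; argmax-sel; f[xs]≤f[argmax]; xs≤max)
import Data.List.Membership.Propositional as List
import Data.List.Membership.Propositional.Properties as ∈ₚ
import Data.List.Properties as Listₚ
open import Data.List.Relation.Binary.Disjoint.Propositional using (Disjoint)
open import Data.List.Relation.Unary.All as All using (All; []; _∷_)
import Data.List.Relation.Unary.All.Properties as Allₚ
open import Data.List.Relation.Unary.Any as Any using (here)
import Data.List.Relation.Unary.Any.Properties as Anyₚ
open import Data.List.Relation.Unary.Unique.Propositional using (Unique; []; _∷_)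
import Data.List.Relation.Unary.Unique.Propositional.Properties as Uniqueₚ
open import Data.Nat
  using (ℕ; zero; suc; _+_; _*_; _∸_; _≤_; _<_; _≥_; _<?_; _≤?_; _!; NonZero; z≤n; s≤s; s≤s⁻¹; z<s; s<s)
open import Data.Nat.Combinatorics using (_C_; nCk+nC[k+1]≡[n+1]C[k+1]; nCn≡1; k>n⇒nCk≡0)
open import Data.Nat.ListAction using (sum)
import Data.Nat.ListAction.Properties as Sumₚ
open import Data.Nat.Properties hiding (_≟_)
open import Data.Nat.Solver using (module +-*-Solver)
open import Data.Product using (_×_; _,_; ∃₂; ∃-syntax; proj₁; proj₂)
open import Data.Sum.Base using (_⊎_; inj₁; inj₂; [_,_]′)
open import Data.Vec.Base as Vec using (Vec; []; _∷_; here; there; lookup; tabulate; updateAt)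
import Data.Vec.Functional as VF
import Data.Vec.Properties as Vecₚ
open import Function.Base using (_∘_; id)
open import Function.Bundles using (mk⇔)
open import Relation.Binary.PropositionalEquality
open import Relation.Nullary using (Dec; yes; no; does; ¬_; contradiction; ¬?; _×-dec_)
open import Relation.Nullary.Decidable using (decidable-stable; dec-true)
open import Relation.Unary using (Pred; Decidable)
open ℝ using (seq; cauchy)

private
  variable
    n : ℕ

-- Weak compositions

wt : ∀ {n} → Subset n → Vec ℕ n → ℕ
wt []            []      = 0
wt (inside ∷ A)  (x ∷ z) = x + wt A z
wt (outside ∷ A) (x ∷ z) = wt A z

incHead : ∀ {n} → Vec ℕ (suc n) → Vec ℕ (suc n)
incHead (x ∷ z) = suc x ∷ z

-- The first entry is either 0 and dropped, or positive and lowered by 1. The cases exclude each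
-- other, so no composition is repeated, and the lengths obey Pascal's recursion.
compositions : ∀ n → ℕ → List (Vec ℕ n)
compositions zero    zero    = [] ∷ []
compositions zero    (suc u) = []
compositions (suc n) zero    = map (0 ∷_) (compositions n zero)
compositions (suc n) (suc u) = map (0 ∷_) (compositions n (suc u)) ++ map incHead (compositions (suc n) u)

∈-compositions⁺ : ∀ {n} u (z : Vec ℕ n) → wt ⊤ z ≡ u → z List.∈ compositions n u
∈-compositions⁺ zero    []          eq = here refl
∈-compositions⁺ zero    (zero ∷ z)  eq = ∈ₚ.∈-map⁺ (0 ∷_) (∈-compositions⁺ zero z eq)
∈-compositions⁺ (suc u) (zero ∷ z)  eq = ∈ₚ.∈-++⁺ˡ (∈ₚ.∈-map⁺ (0 ∷_) (∈-compositions⁺ (suc u) z eq))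
∈-compositions⁺ (suc u) (suc x ∷ z) eq =
  ∈ₚ.∈-++⁺ʳ _ (∈ₚ.∈-map⁺ incHead (∈-compositions⁺ u (x ∷ z) (suc-injective eq)))

∈-compositions⁻ : ∀ n u {z : Vec ℕ n} → z List.∈ compositions n u → wt ⊤ z ≡ u
∈-compositions⁻ zero    zero    (here refl) = refl
∈-compositions⁻ (suc n) zero    z∈ with _ , z′∈ , refl ← ∈ₚ.∈-map⁻ (0 ∷_) z∈ = ∈-compositions⁻ n zero z′∈
∈-compositions⁻ (suc n) (suc u) z∈ with ∈ₚ.∈-++⁻ (map (0 ∷_) (compositions n (suc u))) z∈
... | inj₁ z∈ˡ with _ , z′∈ , refl ← ∈ₚ.∈-map⁻ (0 ∷_) z∈ˡ = ∈-compositions⁻ n (suc u) z′∈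
... | inj₂ z∈ʳ with _ ∷ _ , z′∈ , refl ← ∈ₚ.∈-map⁻ incHead z∈ʳ = cong suc (∈-compositions⁻ (suc n) u z′∈)

compositions-unique : ∀ n u → Unique (compositions n u)
compositions-unique zero    zero    = All.[] ∷ []
compositions-unique zero    (suc u) = []
compositions-unique (suc n) zero    = Uniqueₚ.map⁺ Vecₚ.∷-injectiveʳ (compositions-unique n zero)
compositions-unique (suc n) (suc u) =
  Uniqueₚ.++⁺ (Uniqueₚ.map⁺ Vecₚ.∷-injectiveʳ (compositions-unique n (suc u)))
              (Uniqueₚ.map⁺ incHead-injective (compositions-unique (suc n) u))
              disjoint
  where
  incHead-injective : ∀ {y z : Vec ℕ (suc n)} → incHead y ≡ incHead z → y ≡ z
  incHead-injective {_ ∷ _} {_ ∷ _} refl = refl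
  disjoint : Disjoint (map (0 ∷_) (compositions n (suc u))) (map incHead (compositions (suc n) u))
  disjoint (z∈ˡ , z∈ʳ) with _ , _ , refl ← ∈ₚ.∈-map⁻ (0 ∷_) z∈ˡ | _ ∷ _ , _ , () ← ∈ₚ.∈-map⁻ incHead z∈ʳ

-- The number of weak compositions of the second argument into the first argument many parts. As a
-- sequence, `comp (suc n)` consists of the partial sums of `comp n`, which is what makes summation
-- by parts applicable.
comp : ℕ → ℕ → ℕ
comp zero    zero    = 1
comp zero    (suc u) = 0
comp (suc n) zero    = 1
comp (suc n) (suc u) = comp (suc n) u + comp n (suc u)

comp-zeroʳ : ∀ n → comp n 0 ≡ 1
comp-zeroʳ zero    = refl
comp-zeroʳ (suc n) = refl

-- Convolution and summation by parts

convolve : (ℕ → ℕ) → (ℕ → ℕ) → ℕ → ℕ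
convolve f h zero    = f 0 * h 0
convolve f h (suc u) = f 0 * h (suc u) + convolve (f ∘ suc) h u

convolve-congˡ : ∀ {f f′} h u → f ≗ f′ → convolve f h u ≡ convolve f′ h u
convolve-congˡ h zero    f≗f′ = cong (_* h 0) (f≗f′ 0)
convolve-congˡ h (suc u) f≗f′ = cong₂ _+_ (cong (_* h (suc u)) (f≗f′ 0)) (convolve-congˡ h u (f≗f′ ∘ suc))

convolve-zeroˡ : ∀ {f} h u → (∀ w → f w ≡ 0) → convolve f h u ≡ 0
convolve-zeroˡ h zero    f≗0 = cong (_* h 0) (f≗0 0)
convolve-zeroˡ h (suc u) f≗0 = cong₂ _+_ (cong (_* h (suc u)) (f≗0 0)) (convolve-zeroˡ h u (f≗0 ∘ suc))

module _ where
  open +-*-Solver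

  convolve-distribʳ-+ : ∀ f f′ h u → convolve (λ w → f w + f′ w) h u ≡ convolve f h u + convolve f′ h u
  convolve-distribʳ-+ f f′ h zero    = *-distribʳ-+ (h 0) (f 0) (f′ 0)
  convolve-distribʳ-+ f f′ h (suc u) = trans
    (cong ((f 0 + f′ 0) * h (suc u) +_) (convolve-distribʳ-+ (f ∘ suc) (f′ ∘ suc) h u))
    (solve 5 (λ a b c d e → (a :+ b) :* c :+ (d :+ e) := (a :* c :+ d) :+ (b :* c :+ e)) refl
       (f 0) (f′ 0) (h (suc u)) (convolve (f ∘ suc) h u) (convolve (f′ ∘ suc) h u))

  -- In generating functions, `h′` is h / (1 - x), and multiplying h′ = h + x h′ by f gives the
  -- claim.
  convolve-partialSums : ∀ f {h h′} → h′ 0 ≡ h 0 → (∀ v → h′ (suc v) ≡ h′ v + h (suc v)) → ∀ u →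
    convolve f h′ (suc u) ≡ convolve f h (suc u) + convolve f h′ u
  convolve-partialSums f {h} {h′} h′₀ h′ₛ zero rewrite h′ₛ 0 | h′₀ =
    solve 4 (λ a b c d → a :* (c :+ d) :+ b :* c := (a :* d :+ b :* c) :+ a :* c) refl (f 0) (f 1) (h 0) (h 1)
  convolve-partialSums f {h} {h′} h′₀ h′ₛ (suc u) = trans
    (cong₂ _+_ (cong (f 0 *_) (h′ₛ (suc u))) (convolve-partialSums (f ∘ suc) h′₀ h′ₛ u))
    (solve 5 (λ a c d x y → a :* (c :+ d) :+ (x :+ y) := (a :* d :+ x) :+ (a :* c :+ y)) refl
      (f 0) (h′ (suc u)) (h (2 + u)) (convolve (f ∘ suc) h (suc u)) (convolve (f ∘ suc) h′ u))

  -- Write F (t + 1 + j) as F t + f (t + 1) + ... + f (t + 1 + j). The part F t meets all values of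
  -- g up to r and collects G r; the term f (t + 1 + i) meets g (r - j) for j ≥ i and collects G (r
  -- - i).
  summationByParts : ∀ {f F g G : ℕ → ℕ} → (∀ w → F (suc w) ≡ F w + f (suc w)) →
    G 0 ≡ g 0 → (∀ v → G (suc v) ≡ G v + g (suc v)) → ∀ t r →
    convolve (λ j → F (suc t + j)) g r ≡ convolve (λ j → f (suc t + j)) G r + F t * G r
  summationByParts {f} {F} {g} {G} Fₛ G₀ Gₛ t zero rewrite +-identityʳ t | Fₛ t | G₀ =
    solve 3 (λ a b c → (a :+ b) :* c := b :* c :+ a :* c) refl (F t) (f (suc t)) (g 0)
  summationByParts {f} {F} {g} {G} Fₛ G₀ Gₛ t (suc r)
    rewrite convolve-congˡ {λ j → F (suc t + suc j)} g r (λ j → cong F (+-suc (suc t) j))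
          | convolve-congˡ {λ j → f (suc t + suc j)} G r (λ j → cong f (+-suc (suc t) j))
          | summationByParts {f} {F} {g} {G} Fₛ G₀ Gₛ (suc t) r
          | +-identityʳ t | Gₛ r | Fₛ t =
    solve 5 (λ a b c d x → (a :+ b) :* d :+ (x :+ (a :+ b) :* c) := (b :* (c :+ d) :+ x) :+ a :* (c :+ d)) refl
      (F t) (f (suc t)) (G r) (g (suc r)) (convolve (λ j → f (suc (suc t) + j)) G r)

convolve-drop : ∀ {f} h T r → (∀ w → w < T → f w ≡ 0) →
  convolve f h (T + r) ≡ convolve (λ j → f (T + j)) h r
convolve-drop h zero    r f≗0 = refl
convolve-drop h (suc T) r f≗0 =
  cong₂ _+_ (cong (_* h (suc T + r)) (f≗0 0 z<s)) (convolve-drop h T r (λ w w<T → f≗0 (suc w) (s<s w<T)))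

-- A composition of u consists of a composition of some w on `A` and one of u - w on the complement.
-- In the induction, incrementing a first entry inside `A` shifts `g`, while incrementing one
-- outside `A` replaces the second factor by its partial sums.
sum-compositions : ∀ {n} (A : Subset n) (g : ℕ → ℕ) u →
  sum (map (g ∘ wt A) (compositions n u)) ≡ convolve (λ w → comp ∣ A ∣ w * g w) (comp ∣ ∁ A ∣) u
sum-compositions [] g zero    = solve 1 (λ a → a :+ con 0 := (con 1 :* a) :* con 1) refl (g 0)
  where open +-*-Solver
sum-compositions [] g (suc u) =
  sym (cong₂ _+_ (*-zeroʳ (1 * g 0)) (convolve-zeroˡ {λ _ → 0} (comp 0) u (λ _ → refl)))
sum-compositions {suc n} (inside ∷ A) g zero = trans (cong sum (sym (Listₚ.map-∘ (compositions n 0))))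
  (trans (sum-compositions A g 0) (cong (λ c → c * g 0 * comp (∣ ∁ A ∣) 0) (comp-zeroʳ (∣ A ∣))))
sum-compositions {suc n} (outside ∷ A) g zero = trans (cong sum (sym (Listₚ.map-∘ (compositions n 0))))
  (trans (sum-compositions A g 0) (cong (comp (∣ A ∣) 0 * g 0 *_) (comp-zeroʳ (∣ ∁ A ∣))))
sum-compositions {suc n} (inside ∷ A) g (suc u) = begin
  sum (map (g ∘ wt (inside ∷ A)) (map (0 ∷_) L ++ map incHead L′))
    ≡⟨ cong sum (Listₚ.map-++ (g ∘ wt (inside ∷ A)) (map (0 ∷_) L) (map incHead L′)) ⟩
  sum (map (g ∘ wt (inside ∷ A)) (map (0 ∷_) L) ++ map (g ∘ wt (inside ∷ A)) (map incHead L′))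
    ≡⟨ Sumₚ.sum-++ (map (g ∘ wt (inside ∷ A)) (map (0 ∷_) L)) _ ⟩
  sum (map (g ∘ wt (inside ∷ A)) (map (0 ∷_) L)) + sum (map (g ∘ wt (inside ∷ A)) (map incHead L′))
    ≡⟨ cong₂ (λ x y → sum x + sum y) (sym (Listₚ.map-∘ L))
         (trans (sym (Listₚ.map-∘ L′)) (Listₚ.map-cong (λ { (_ ∷ _) → refl }) L′)) ⟩
  sum (map (g ∘ wt A) L) + sum (map (g ∘ suc ∘ wt (inside ∷ A)) L′)
    ≡⟨ cong₂ _+_ (sum-compositions A g (suc u)) (sum-compositions (inside ∷ A) (g ∘ suc) u) ⟩
  (comp a 0 * g 0 * h (suc u) + convolve (λ w → comp a (suc w) * g (suc w)) h u)
    + convolve (λ w → comp (suc a) w * g (suc w)) h u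
    ≡⟨ +-assoc (comp a 0 * g 0 * h (suc u)) _ _ ⟩
  comp a 0 * g 0 * h (suc u) + (convolve (λ w → comp a (suc w) * g (suc w)) h u
    + convolve (λ w → comp (suc a) w * g (suc w)) h u)
    ≡⟨ cong₂ _+_ (cong (λ c → c * g 0 * h (suc u)) (comp-zeroʳ a))
         (trans (+-comm (convolve (λ w → comp a (suc w) * g (suc w)) h u) _)
         (trans (sym (convolve-distribʳ-+ (λ w → comp (suc a) w * g (suc w)) (λ w → comp a (suc w) * g (suc w)) h u))
           (convolve-congˡ h u λ w → sym (*-distribʳ-+ (g (suc w)) (comp (suc a) w) (comp a (suc w)))))) ⟩
  1 * g 0 * h (suc u) + convolve (λ w → comp (suc a) (suc w) * g (suc w)) h u ∎
  where
  open ≡-Reasoning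
  L = compositions n (suc u)
  L′ = compositions (suc n) u
  a = ∣ A ∣
  h = comp ∣ ∁ A ∣
sum-compositions {suc n} (outside ∷ A) g (suc u) = begin
  sum (map (g ∘ wt (outside ∷ A)) (map (0 ∷_) L ++ map incHead L′))
    ≡⟨ cong sum (Listₚ.map-++ (g ∘ wt (outside ∷ A)) (map (0 ∷_) L) (map incHead L′)) ⟩
  sum (map (g ∘ wt (outside ∷ A)) (map (0 ∷_) L) ++ map (g ∘ wt (outside ∷ A)) (map incHead L′))
    ≡⟨ Sumₚ.sum-++ (map (g ∘ wt (outside ∷ A)) (map (0 ∷_) L)) _ ⟩
  sum (map (g ∘ wt (outside ∷ A)) (map (0 ∷_) L)) + sum (map (g ∘ wt (outside ∷ A)) (map incHead L′))
    ≡⟨ cong₂ (λ x y → sum x + sum y) (sym (Listₚ.map-∘ L))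
         (trans (sym (Listₚ.map-∘ L′)) (Listₚ.map-cong (λ { (_ ∷ _) → refl }) L′)) ⟩
  sum (map (g ∘ wt A) L) + sum (map (g ∘ wt (outside ∷ A)) L′)
    ≡⟨ cong₂ _+_ (sum-compositions A g (suc u)) (sum-compositions (outside ∷ A) g u) ⟩
  convolve f (comp b) (suc u) + convolve f (comp (suc b)) u
    ≡⟨ convolve-partialSums f (sym (comp-zeroʳ b)) (λ _ → refl) u ⟨
  convolve f (comp (suc b)) (suc u) ∎
  where
  open ≡-Reasoning
  L = compositions n (suc u)
  L′ = compositions (suc n) u
  b = ∣ ∁ A ∣
  f = λ w → comp ∣ A ∣ w * g w

length-compositions : ∀ n u → List.length (compositions n u) ≡ comp n u
length-compositions zero    zero    = refl
length-compositions zero    (suc u) = refl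
length-compositions (suc n) zero    = trans (Listₚ.length-map (0 ∷_) (compositions n 0)) (trans (length-compositions n 0) (comp-zeroʳ n))
length-compositions (suc n) (suc u) = begin
  List.length (map (0 ∷_) L ++ map incHead L′)                ≡⟨ Listₚ.length-++ (map (0 ∷_) L) ⟩
  List.length (map (0 ∷_) L) + List.length (map incHead L′)   ≡⟨ cong₂ _+_ (Listₚ.length-map (0 ∷_) L) (Listₚ.length-map incHead L′) ⟩
  List.length L + List.length L′                              ≡⟨ cong₂ _+_ (length-compositions n (suc u)) (length-compositions (suc n) u) ⟩
  comp n (suc u) + comp (suc n) u                             ≡⟨ +-comm (comp n (suc u)) _ ⟩
  comp (suc n) (suc u) ∎
  where
  open ≡-Reasoning
  L = compositions n (suc u)
  L′ = compositions (suc n) u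

-- The summand k = j + 1 of P a N, evaluated at t + 1.
excess : ℕ → ℕ → ℕ → ℕ
excess N t j = comp (suc (N ∸ suc j)) t * comp (suc j) (suc t)

-- Each summation by parts moves one coordinate from the first block to the second, keeping a + b.
-- The boundary term counts the case in which this coordinate carries the partial sum past t + 1.
-- With an empty first block nothing is left, as `comp 0` vanishes at positive arguments.
convolve-excess : ∀ t a b →
  convolve (λ j → comp a (suc (suc t) + j)) (comp b) t ≡ sum (map (excess (a + b) t) (upTo a))
convolve-excess t zero    b = convolve-zeroˡ (comp b) t (λ _ → refl)
convolve-excess t (suc a) b = begin
  convolve (λ j → comp (suc a) (suc (suc t) + j)) (comp b) t
    ≡⟨ summationByParts {comp a} {comp (suc a)} {comp b} {comp (suc b)} (λ _ → refl) (sym (comp-zeroʳ b)) (λ _ → refl) (suc t) t ⟩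
  convolve (λ j → comp a (suc (suc t) + j)) (comp (suc b)) t + comp (suc a) (suc t) * comp (suc b) t
    ≡⟨ cong₂ _+_ (trans (convolve-excess t a (suc b)) (cong (λ N → sum (map (excess N t) (upTo a))) (+-suc a b)))
                 (trans (*-comm (comp (suc a) (suc t)) _) (cong (λ m → comp (suc m) t * comp (suc a) (suc t)) (sym (m+n∸m≡n (suc a) b)))) ⟩
  sum (map (excess (suc a + b) t) (upTo a)) + excess (suc a + b) t a
    ≡⟨ cong (sum (map (excess (suc a + b) t) (upTo a)) +_) (sym (+-identityʳ _)) ⟩
  sum (map (excess (suc a + b) t) (upTo a)) + sum (map (excess (suc a + b) t) (a ∷ []))
    ≡⟨ Sumₚ.sum-++ (map (excess (suc a + b) t) (upTo a)) _ ⟨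
  sum (map (excess (suc a + b) t) (upTo a) ++ map (excess (suc a + b) t) (a ∷ []))
    ≡⟨ cong sum (Listₚ.map-++ _ (upTo a) (a ∷ [])) ⟨
  sum (map (excess (suc a + b) t) (upTo a ++ a ∷ []))
    ≡⟨ cong (sum ∘ map (excess (suc a + b) t)) (Listₚ.upTo-∷ʳ a) ⟩
  sum (map (excess (suc a + b) t) (upTo (suc a))) ∎
  where open ≡-Reasoning

𝟙 : ∀ {a} {A : Set a} → Dec A → ℕ
𝟙 (yes _) = 1
𝟙 (no _)  = 0

𝟙-yes : ∀ {a} {A : Set a} (A? : Dec A) → A → 𝟙 A? ≡ 1
𝟙-yes (yes _) _ = refl
𝟙-yes (no ¬a) a = contradiction a ¬a

𝟙-no : ∀ {a} {A : Set a} (A? : Dec A) → ¬ A → 𝟙 A? ≡ 0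
𝟙-no (yes a) ¬a = contradiction a ¬a
𝟙-no (no _)  _  = refl

𝟙-cong : ∀ {a b} {A : Set a} {B : Set b} (A? : Dec A) (B? : Dec B) → (A → B) → (B → A) → 𝟙 A? ≡ 𝟙 B?
𝟙-cong (yes a) B? f g = sym (𝟙-yes B? (f a))
𝟙-cong (no ¬a) B? f g = sym (𝟙-no B? (¬a ∘ g))

∣A∣+∣∁A∣≡n : ∀ {n} (A : Subset n) → ∣ A ∣ + ∣ ∁ A ∣ ≡ n
∣A∣+∣∁A∣≡n []            = refl
∣A∣+∣∁A∣≡n (inside ∷ A)  = cong suc (∣A∣+∣∁A∣≡n A)
∣A∣+∣∁A∣≡n (outside ∷ A) = trans (+-suc ∣ A ∣ ∣ ∁ A ∣) (cong suc (∣A∣+∣∁A∣≡n A))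

heavyCount : ∀ {n} → Subset n → ℕ → ℕ
heavyCount {n} A t = sum (map (λ z → 𝟙 (t <? wt A z)) (compositions n (t + t)))

heavyCount-zero : ∀ {n} (A : Subset n) → heavyCount A 0 ≡ 0
heavyCount-zero A = trans (sum-compositions A (λ w → 𝟙 (0 <? w)) 0) (cong (_* comp ∣ ∁ A ∣ 0) (*-zeroʳ (comp ∣ A ∣ 0)))

heavyCount-suc : ∀ {n} (A : Subset n) t → heavyCount A (suc t) ≡ sum (map (excess n t) (upTo ∣ A ∣))
heavyCount-suc {n} A t = begin
  heavyCount A (suc t)
    ≡⟨ sum-compositions A heavy (suc t + suc t) ⟩
  convolve (λ w → comp a w * heavy w) (comp b) (suc t + suc t)
    -- The total 2 (t + 1) is split as (t + 2) + t because t + 2 is the least heavy weight; all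
    -- smaller indices contribute 0.
    ≡⟨ cong (convolve (λ w → comp a w * heavy w) (comp b)) (+-suc (suc t) t) ⟩
  convolve (λ w → comp a w * heavy w) (comp b) (suc (suc t) + t)
    ≡⟨ convolve-drop (comp b) (suc (suc t)) t (λ w w<T → trans
         (cong (comp a w *_) (𝟙-no (suc t <? w) (<⇒≱ w<T))) (*-zeroʳ (comp a w))) ⟩
  convolve (λ j → comp a (suc (suc t) + j) * heavy (suc (suc t) + j)) (comp b) t
    ≡⟨ convolve-congˡ (comp b) t (λ j → trans
         (cong (comp a (suc (suc t) + j) *_) (𝟙-yes (suc t <? (suc (suc t) + j)) (m≤m+n (suc (suc t)) j))) (*-identityʳ _)) ⟩
  convolve (λ j → comp a (suc (suc t) + j)) (comp b) t
    ≡⟨ convolve-excess t a b ⟩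
  sum (map (excess (a + b) t) (upTo a))
    ≡⟨ cong (λ N → sum (map (excess N t) (upTo a))) (∣A∣+∣∁A∣≡n A) ⟩
  sum (map (excess n t) (upTo a)) ∎
  where
  a = ∣ A ∣
  b = ∣ ∁ A ∣
  open ≡-Reasoning
  heavy : ℕ → ℕ
  heavy w = 𝟙 (suc t <? w)

-- Matroids of rank 2

x∈p⇒1≤∣p∣ : ∀ {x} {p : Subset n} → x ∈ p → 1 ≤ ∣ p ∣
x∈p⇒1≤∣p∣ {x = x} x∈p = subst (_≤ _) (∣⁅x⁆∣≡1 x)
  (p⊆q⇒∣p∣≤∣q∣ λ y∈ → subst (_∈ _) (sym (x∈⁅y⁆⇒x≡y x y∈)) x∈p)

distinct⇒2≤∣p∣ : ∀ {x y} {p : Subset n} → x ∈ p → y ∈ p → x ≢ y → 2 ≤ ∣ p ∣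
distinct⇒2≤∣p∣ {x = x} {y} x∈p y∈p x≢y = subst (_< _) (∣⁅x⁆∣≡1 x)
  (p⊂q⇒∣p∣<∣q∣ ((λ z∈ → subst (_∈ _) (sym (x∈⁅y⁆⇒x≡y x z∈)) x∈p) , y , y∈p , x≢y⇒x∉⁅y⁆ (x≢y ∘ sym)))

1≤∣p∣⇒∃ : (p : Subset n) → 1 ≤ ∣ p ∣ → ∃[ x ] x ∈ p
1≤∣p∣⇒∃ (inside ∷ p)  _ = zero , here
1≤∣p∣⇒∃ (outside ∷ p) h = let x , x∈p = 1≤∣p∣⇒∃ p h in suc x , there x∈p

2≤∣p∣⇒distinct : (p : Subset n) → 2 ≤ ∣ p ∣ → ∃₂ λ x y → x ∈ p × y ∈ p × x ≢ y
2≤∣p∣⇒distinct (inside ∷ p)  h =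
  let y , y∈p = 1≤∣p∣⇒∃ p (s≤s⁻¹ h) in zero , suc y , here , there y∈p , λ ()
2≤∣p∣⇒distinct (outside ∷ p) h =
  let x , y , x∈p , y∈p , x≢y = 2≤∣p∣⇒distinct p h
  in suc x , suc y , there x∈p , there y∈p , x≢y ∘ Finₚ.suc-injective

∈pair⁻ : ∀ {x y z : Fin n} → z ∈ ⁅ x ⁆ ∪ ⁅ y ⁆ → z ≡ x ⊎ z ≡ y
∈pair⁻ {x = x} {y} z∈ with x∈p∪q⁻ ⁅ x ⁆ ⁅ y ⁆ z∈
... | inj₁ z∈x = inj₁ (x∈⁅y⁆⇒x≡y x z∈x)
... | inj₂ z∈y = inj₂ (x∈⁅y⁆⇒x≡y y z∈y)

∈pairˡ : ∀ (x y : Fin n) → x ∈ ⁅ x ⁆ ∪ ⁅ y ⁆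
∈pairˡ x y = x∈p∪q⁺ (inj₁ (x∈⁅x⁆ x))

∈pairʳ : ∀ (x y : Fin n) → y ∈ ⁅ x ⁆ ∪ ⁅ y ⁆
∈pairʳ x y = x∈p∪q⁺ (inj₂ (x∈⁅x⁆ y))

pair⊆ : ∀ {x y} {p : Subset n} → x ∈ p → y ∈ p → ⁅ x ⁆ ∪ ⁅ y ⁆ ⊆ p
pair⊆ x∈p y∈p z∈ with ∈pair⁻ z∈
... | inj₁ refl = x∈p
... | inj₂ refl = y∈p

∣p∣≡2⇒p≡pair : ∀ {x y} {p : Subset n} → ∣ p ∣ ≡ 2 → x ∈ p → y ∈ p → x ≢ y → p ≡ ⁅ x ⁆ ∪ ⁅ y ⁆
∣p∣≡2⇒p≡pair {x = x} {y} {p} ∣p∣≡2 x∈p y∈p x≢y = ⊆-antisym p⊆ (pair⊆ x∈p y∈p)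
  where
  p⊆ : p ⊆ ⁅ x ⁆ ∪ ⁅ y ⁆
  p⊆ {z} z∈p with z ∈? (⁅ x ⁆ ∪ ⁅ y ⁆)
  ... | yes z∈ = z∈
  ... | no  z∉ = contradiction
    (≤-trans (s≤s (distinct⇒2≤∣p∣ (∈pairˡ x y) (∈pairʳ x y) x≢y)) (p⊂q⇒∣p∣<∣q∣ (pair⊆ x∈p y∈p , z , z∈p , z∉)))
    (<⇒≱ (s≤s (≤-reflexive ∣p∣≡2)))

select : ∀ {ℓ} {P : Pred (Fin n) ℓ} → Decidable P → Subset n
select P? = tabulate (does ∘ P?)

module _ {ℓ} {P : Pred (Fin n) ℓ} (P? : Decidable P) where

  ∈-select⁺ : ∀ {x} → P x → x ∈ select P?
  ∈-select⁺ {x} Px = Vecₚ.lookup⇒[]= x (select P?) (trans (Vecₚ.lookup∘tabulate (does ∘ P?) x) (dec-true (P? x) Px))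

  ∈-select⁻ : ∀ {x} → x ∈ select P? → P x
  ∈-select⁻ {x} x∈ with P? x | trans (sym (Vecₚ.lookup∘tabulate (does ∘ P?) x)) (Vecₚ.[]=⇒lookup x∈)
  ... | yes Px | _  = Px

∈-allSubsets : (p : Subset n) → p List.∈ allSubsets n
∈-allSubsets []            = here refl
∈-allSubsets (outside ∷ p) = ∈ₚ.∈-++⁺ˡ (∈ₚ.∈-map⁺ (outside ∷_) (∈-allSubsets p))
∈-allSubsets {suc n} (inside ∷ p) =
  ∈ₚ.∈-++⁺ʳ (List.map (outside ∷_) (allSubsets n)) (∈ₚ.∈-map⁺ (inside ∷_) (∈-allSubsets p))

module _ {E : Subset n} (M : Matroid E) where
  open Matroid M

  private
    sizes : Subset n → List ℕ
    sizes A = List.map (λ B → ∣ A ∩ B ∣) (List.filter base? (allSubsets n))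

  ∣A∩B∣≤rank : ∀ A {B} → Base B → ∣ A ∩ B ∣ ≤ rank M A
  ∣A∩B∣≤rank A {B} b = All.lookup (xs≤max 0 (sizes A))
    (∈ₚ.∈-map⁺ (λ B → ∣ A ∩ B ∣) (∈ₚ.∈-filter⁺ base? (∈-allSubsets B) b))

  abstract
    rank-attained : ∀ A → ∃[ B ] Base B × rank M A ≡ ∣ A ∩ B ∣
    rank-attained A with argmax-sel id 0 (sizes A)
    -- When the maximum is its default 0, any base attains it, since no intersection exceeds the
    -- rank.
    ... | inj₁ rank≡0 = let B , b = nonempty in B , b ,
      trans rank≡0 (sym (n≤0⇒n≡0 (subst (∣ A ∩ B ∣ ≤_) rank≡0 (∣A∩B∣≤rank A b))))
    ... | inj₂ rank∈ = let B , B∈ , eq = ∈ₚ.∈-map⁻ (λ B → ∣ A ∩ B ∣) rank∈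
                       in B , proj₂ (∈ₚ.∈-filter⁻ base? {xs = allSubsets n} B∈) , eq

uniform₁ : (S : Subset n) → ∃[ x ] x ∈ S → Matroid S
uniform₁ S (x₀ , x₀∈S) = record
  { Base     = λ B → ∃[ x ] x ∈ S × B ≡ ⁅ x ⁆
  ; base?    = λ B → any? λ x → (x ∈? S) ×-dec Vecₚ.≡-dec Boolₚ._≟_ B ⁅ x ⁆
  ; base⊆E   = λ { (x , x∈S , refl) y∈ → subst (_∈ S) (sym (x∈⁅y⁆⇒x≡y x y∈)) x∈S }
  ; nonempty = ⁅ x₀ ⁆ , x₀ , x₀∈S , refl
  ; exchange = λ { {x = z} (x , x∈S , refl) (y , y∈S , refl) z∈x z∉y →
      y , x∈⁅x⁆ y , (λ y∈x → z∉y (subst (_∈ ⁅ y ⁆) (trans (x∈⁅y⁆⇒x≡y x y∈x) (sym (x∈⁅y⁆⇒x≡y x z∈x))) (x∈⁅x⁆ y))) ,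
      y , y∈S , ⊆-antisym
        (λ {w} w∈ → [ (λ w∈- → contradiction (trans (x∈⁅y⁆⇒x≡y x (p─q⊆p ⁅ x ⁆ ⁅ z ⁆ w∈-)) (sym (x∈⁅y⁆⇒x≡y x z∈x))) (x∈p-y⇒x≢y ⁅ x ⁆ w∈-)) , id ]′
                    (x∈p∪q⁻ (⁅ x ⁆ - z) ⁅ y ⁆ w∈))
        (λ w∈ → x∈p∪q⁺ (inj₂ w∈)) }
  }
  where
  x∈p-y⇒x≢y : ∀ {x y} (p : Subset n) → x ∈ p - y → x ≢ y
  x∈p-y⇒x≢y {x = zero}  {suc y} p x∈ ()
  x∈p-y⇒x≢y {x = suc x} {zero} (_ ∷ p) x∈ ()
  x∈p-y⇒x≢y {x = zero}  {zero} (_ ∷ p) () refl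
  x∈p-y⇒x≢y {x = suc x} {suc x} (_ ∷ p) (there x∈) refl = x∈p-y⇒x≢y p x∈ refl

module Rank2 {n} (M : Matroid (⊤ {n})) (rk≡2 : rk M ≡ 2) where
  open Matroid M

  abstract
    -- The rank bounds every base from above and is attained by some base `B₀`. Elements of `B₀`
    -- missing from `B` are exchanged for elements of `B` outside `B₀`, which yields two distinct
    -- elements of `B`.
    base⇒∣B∣≡2 : ∀ {B} → Base B → ∣ B ∣ ≡ 2
    base⇒∣B∣≡2 {B} b = ≤-antisym
      (subst (∣ B ∣ ≤_) rk≡2 (subst (λ C → ∣ C ∣ ≤ rk M) (∩-identityˡ B) (∣A∩B∣≤rank M ⊤ b))) 2≤∣B∣
      where
      2≤∣B∣ : 2 ≤ ∣ B ∣
      2≤∣B∣ with rank-attained M ⊤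
      ... | B₀ , b₀ , eq with 2≤∣p∣⇒distinct B₀ (≤-reflexive (trans (sym rk≡2) (trans eq (cong ∣_∣ (∩-identityˡ B₀)))))
      ... | p , q , p∈ , q∈ , p≢q with p ∈? B | q ∈? B
      ... | yes p∈B | yes q∈B = distinct⇒2≤∣p∣ p∈B q∈B p≢q
      ... | yes p∈B | no q∉B with y , y∈B , y∉B₀ , _ ← exchange b₀ b q∈ q∉B =
        distinct⇒2≤∣p∣ p∈B y∈B λ { refl → y∉B₀ p∈ }
      ... | no p∉B | yes q∈B with y , y∈B , y∉B₀ , _ ← exchange b₀ b p∈ p∉B =
        distinct⇒2≤∣p∣ q∈B y∈B λ { refl → y∉B₀ q∈ }
      -- The second exchange starts from the base that already contains `y`, which forces `z` to
      -- differ from `y`.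
      ... | no p∉B | no q∉B with y , y∈B , y∉B₀ , b₁ ← exchange b₀ b p∈ p∉B
        with z , z∈B , z∉B₁ , _ ← exchange b₁ b (x∈p∪q⁺ (inj₁ (x∈p∧x≢y⇒x∈p-y q∈ (p≢q ∘ sym)))) q∉B =
        distinct⇒2≤∣p∣ y∈B z∈B λ { refl → z∉B₁ (x∈p∪q⁺ (inj₂ (x∈⁅x⁆ y))) }

  infix 4 _⋈_ _⋈?_

  -- Non-parallelism is taken as the primitive relation because it is read off from the bases;
  -- parallelism is its decidable complement. A loop is related to nothing.
  _⋈_ : Fin n → Fin n → Set
  p ⋈ q = Base (⁅ p ⁆ ∪ ⁅ q ⁆)

  _⋈?_ : ∀ p q → Dec (p ⋈ q)
  p ⋈? q = base? (⁅ p ⁆ ∪ ⁅ q ⁆)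

  base⇒⋈ : ∀ {B p q} → Base B → p ∈ B → q ∈ B → p ≢ q → p ⋈ q
  base⇒⋈ b p∈ q∈ p≢q = subst Base (∣p∣≡2⇒p≡pair (base⇒∣B∣≡2 b) p∈ q∈ p≢q) b

  abstract
    base⇒∃⋈ : ∀ {B} → Base B → ∃₂ λ p q → p ⋈ q × B ≡ ⁅ p ⁆ ∪ ⁅ q ⁆
    base⇒∃⋈ {B} b =
      let p , q , p∈ , q∈ , p≢q = 2≤∣p∣⇒distinct B (≤-reflexive (sym (base⇒∣B∣≡2 b)))
      in p , q , base⇒⋈ b p∈ q∈ p≢q , ∣p∣≡2⇒p≡pair (base⇒∣B∣≡2 b) p∈ q∈ p≢q

  ⋈-irrefl : ∀ {p q} → p ⋈ q → p ≢ q
  ⋈-irrefl {p} b refl with x , y , x∈ , y∈ , x≢y ← 2≤∣p∣⇒distinct (⁅ p ⁆ ∪ ⁅ p ⁆) (≤-reflexive (sym (base⇒∣B∣≡2 b))) =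
    x≢y (trans ([ id , id ]′ (∈pair⁻ x∈)) (sym ([ id , id ]′ (∈pair⁻ y∈))))

  ⋈-sym : ∀ {p q} → p ⋈ q → q ⋈ p
  ⋈-sym {p} {q} = subst Base (∪-comm ⁅ p ⁆ ⁅ q ⁆)

  -- Contrapositively, parallelism is transitive through `q`, provided that `q` is not a loop, as q
  -- ⋈ q′ ensures. Exchanging q′ in {q, q′} against {p, r} leaves q paired with p or with r.
  ⋈-cotrans : ∀ {p q q′ r} → q ⋈ q′ → p ⋈ r → p ⋈ q ⊎ q ⋈ r
  ⋈-cotrans {p} {q} {q′} {r} qq′ pr with q ≟ p | q ≟ r | q′ ≟ p | q′ ≟ r
  ... | yes refl | _ | _ | _ = inj₂ pr
  ... | _ | yes refl | _ | _ = inj₁ pr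
  ... | _ | _ | yes refl | _ = inj₁ (⋈-sym qq′)
  ... | _ | _ | _ | yes refl = inj₂ qq′
  ... | no _ | no _ | no q′≢p | no q′≢r
    with y , y∈ , y∉ , b ← exchange qq′ pr (∈pairʳ q q′) (λ q′∈ → [ q′≢p , q′≢r ]′ (∈pair⁻ q′∈))
    with qy ← base⇒⋈ b (x∈p∪q⁺ (inj₁ (x∈p∧x≢y⇒x∈p-y (∈pairˡ q q′) (⋈-irrefl qq′)))) (x∈p∪q⁺ (inj₂ (x∈⁅x⁆ y)))
                       (λ { refl → y∉ (∈pairˡ q q′) })
    with ∈pair⁻ y∈
  ... | inj₁ refl = inj₁ (⋈-sym qy)
  ... | inj₂ refl = inj₂ qy

  -- The flat spanned by a non-loop `p`, which is its parallel class once loops are excluded. For a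
  -- loop it would be the whole ground set.
  cl : Fin n → Subset n
  cl p = select λ q → ¬? (p ⋈? q)

  ∈-cl⁺ : ∀ {p q} → ¬ p ⋈ q → q ∈ cl p
  ∈-cl⁺ {p} = ∈-select⁺ λ q → ¬? (p ⋈? q)

  ∈-cl⁻ : ∀ {p q} → q ∈ cl p → ¬ p ⋈ q
  ∈-cl⁻ {p} = ∈-select⁻ λ q → ¬? (p ⋈? q)

  ∉-cl⁻ : ∀ {p q} → q ∉ cl p → p ⋈ q
  ∉-cl⁻ {p} {q} q∉ = decidable-stable (p ⋈? q) (q∉ ∘ ∈-cl⁺)

  p∈cl[p] : ∀ p → p ∈ cl p
  p∈cl[p] p = ∈-cl⁺ λ pp → ⋈-irrefl pp refl

  ⋈⇒2≤rank : ∀ {A p q} → p ∈ A → q ∈ A → p ⋈ q → 2 ≤ rank M A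
  ⋈⇒2≤rank {A} {p} {q} p∈A q∈A pq = ≤-trans
    (distinct⇒2≤∣p∣ (x∈p∩q⁺ (p∈A , ∈pairˡ p q)) (x∈p∩q⁺ (q∈A , ∈pairʳ p q)) (⋈-irrefl pq))
    (∣A∩B∣≤rank M A pq)

  2≤rank⇒⋈ : ∀ A → 2 ≤ rank M A → ∃₂ λ p q → p ∈ A × q ∈ A × p ⋈ q
  2≤rank⇒⋈ A 2≤ with B , b , eq ← rank-attained M A
    with p , q , p∈ , q∈ , p≢q ← 2≤∣p∣⇒distinct (A ∩ B) (subst (2 ≤_) eq 2≤)
    with p∈A , p∈B ← x∈p∩q⁻ A B p∈ | q∈A , q∈B ← x∈p∩q⁻ A B q∈ = p , q , p∈A , q∈A , base⇒⋈ b p∈B q∈B p≢q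

  1≤rank⇒∃ : ∀ A → 1 ≤ rank M A → ∃[ p ] p ∈ A
  1≤rank⇒∃ A 1≤ with B , b , eq ← rank-attained M A
    with p , p∈ ← 1≤∣p∣⇒∃ (A ∩ B) (subst (1 ≤_) eq 1≤) = p , p∩q⊆p A B p∈

  -- A loop lies in no base, so it splits off as a summand of rank 0 and the other summand keeps all
  -- the bases. The singleton is a proper part because a base supplies another element.
  connected⇒loopless : Connected M → ∀ p → ∃[ q ] p ⋈ q
  connected⇒loopless conn p with any? (p ⋈?_)
  ... | yes ∃q = ∃q
  ... | no ∄q = ⊥-elim (conn
    (⁅ p ⁆ , ∁ ⁅ p ⁆ , (⊆⊤ , other , ∈⊤ , x≢y⇒x∉⁅y⁆ other≢p) , (⊆⊤ , p , ∈⊤ , x∈p⇒x∉∁p (x∈⁅x⁆ p)) , loop , rest , isDirectSum))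
    where
    p∉base : ∀ {B} → Base B → p ∉ B
    p∉base b p∈B with x , y , xy , refl ← base⇒∃⋈ b with ∈pair⁻ p∈B
    ... | inj₁ refl = ∄q (y , xy)
    ... | inj₂ refl = ∄q (x , ⋈-sym xy)
    ∃≢p : ∃[ q ] q ≢ p
    ∃≢p = let B , b = nonempty ; x , y , xy , B≡ = base⇒∃⋈ b
          in x , λ { refl → ∄q (y , xy) }
    other = proj₁ ∃≢p
    other≢p = proj₂ ∃≢p
    loop : Matroid ⁅ p ⁆
    loop = record
      { Base     = _≡ ⊥
      ; base?    = λ B → Vecₚ.≡-dec Boolₚ._≟_ B ⊥
      ; base⊆E   = λ { refl x∈ → contradiction x∈ ∉⊥ }
      ; nonempty = ⊥ , refl
      ; exchange = λ { refl _ x∈ _ → contradiction x∈ ∉⊥ }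
      }
    rest : Matroid (∁ ⁅ p ⁆)
    rest = record
      { Base     = Base
      ; base?    = base?
      ; base⊆E   = λ b x∈B → x∉p⇒x∈∁p λ x∈p → p∉base b (subst (_∈ _) (x∈⁅y⁆⇒x≡y p x∈p) x∈B)
      ; nonempty = nonempty
      ; exchange = exchange
      }
    isDirectSum : IsDirectSum M loop rest
    isDirectSum = record
      { union    = p∪∁p≡⊤ ⁅ p ⁆
      ; disjoint = ∩-inverseʳ ⁅ p ⁆
      ; bases    = λ B → mk⇔ (λ b → ⊥ , B , refl , b , sym (∪-identityˡ B))
                            (λ { (_ , B₂ , refl , b , refl) → subst Base (sym (∪-identityˡ B₂)) b })
      }

  module Loopless (loopless : ∀ p → ∃[ q ] p ⋈ q) where

    ∥-trans : ∀ {p q r} → q ∈ cl p → r ∈ cl p → ¬ q ⋈ r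
    ∥-trans {p} q∈ r∈ qr with ⋈-cotrans (proj₂ (loopless p)) qr
    ... | inj₁ qp = ∈-cl⁻ q∈ (⋈-sym qp)
    ... | inj₂ pr = ∈-cl⁻ r∈ pr

    ⋈-∥ : ∀ {p q r} → p ⋈ r → q ∈ cl p → q ⋈ r
    ⋈-∥ {p} {q} pr q∈ with ⋈-cotrans (proj₂ (loopless q)) pr
    ... | inj₁ pq = contradiction pq (∈-cl⁻ q∈)
    ... | inj₂ qr = qr

    rank-cl : ∀ p → rank M (cl p) ≡ 1
    rank-cl p = ≤-antisym
      (≮⇒≥ λ 2≤ → let _ , _ , x∈ , y∈ , xy = 2≤rank⇒⋈ (cl p) 2≤ in ∥-trans x∈ y∈ xy)
      (let q , pq = loopless p
       in ≤-trans (x∈p⇒1≤∣p∣ (x∈p∩q⁺ (p∈cl[p] p , ∈pairˡ p q))) (∣A∩B∣≤rank M (cl p) pq))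

    cl-isHyperplane : ∀ p → IsHyperplane M (cl p)
    cl-isHyperplane p =
      (⊆⊤ , λ {q} _ q∉ → subst (_< rank M (cl p ∪ ⁅ q ⁆)) (sym (rank-cl p))
        (⋈⇒2≤rank (x∈p∪q⁺ (inj₁ (p∈cl[p] p))) (x∈p∪q⁺ (inj₂ (x∈⁅x⁆ q))) (∉-cl⁻ q∉))) ,
      trans (cong suc (rank-cl p)) (sym rk≡2)

    module _ {H : Subset n} (hyp : IsHyperplane M H) where

      rank-hyperplane : rank M H ≡ 1
      rank-hyperplane = suc-injective (trans (proj₂ hyp) rk≡2)

      hyperplane-nonempty : ∃[ p ] p ∈ H
      hyperplane-nonempty = 1≤rank⇒∃ H (≤-reflexive (sym rank-hyperplane))

      -- A hyperplane has rank 1, so it contains no base and all its elements are parallel to `p`.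
      -- If a parallel `q` were missing, flatness would give H ∪ {q} rank 2, and thus a base inside
      -- `cl p`.
      hyperplane≡cl : ∀ {p} → p ∈ H → H ≡ cl p
      hyperplane≡cl {p} p∈H = ⊆-antisym H⊆cl cl⊆H
        where
        H⊆cl : H ⊆ cl p
        H⊆cl q∈H = ∈-cl⁺ λ pq → <⇒≱ (⋈⇒2≤rank p∈H q∈H pq) (≤-reflexive rank-hyperplane)
        cl⊆H : cl p ⊆ H
        cl⊆H {q} q∈cl with q ∈? H
        ... | yes q∈H = q∈H
        ... | no q∉H =
          let x , y , x∈ , y∈ , xy = 2≤rank⇒⋈ (H ∪ ⁅ q ⁆) (subst (_< rank M (H ∪ ⁅ q ⁆)) rank-hyperplane (proj₂ (proj₁ hyp) ∈⊤ q∉H))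
          in contradiction xy (∥-trans (∪⊆cl x∈) (∪⊆cl y∈))
          where
          ∪⊆cl : H ∪ ⁅ q ⁆ ⊆ cl p
          ∪⊆cl x∈ = [ H⊆cl , (λ x∈q → subst (_∈ cl p) (sym (x∈⁅y⁆⇒x≡y q x∈q)) q∈cl) ]′ (x∈p∪q⁻ H ⁅ q ⁆ x∈)

    -- Without a third class everything outside `cl p` is parallel to `q`. Every base then has one
    -- element on each side, and conversely every such pair is a base.
    connected⇒thirdClass : Connected M → ∀ {p q} → p ⋈ q → ∃[ r ] p ⋈ r × q ⋈ r
    connected⇒thirdClass conn {p} {q} pq with any? (λ r → (p ⋈? r) ×-dec (q ⋈? r))
    ... | yes ∃r = ∃r
    ... | no ∄r = ⊥-elim (conn
      (cl p , ∁ (cl p) , (⊆⊤ , q , ∈⊤ , λ q∈ → ∈-cl⁻ q∈ pq) , (⊆⊤ , p , ∈⊤ , x∈p⇒x∉∁p (p∈cl[p] p)) ,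
       M₁ , M₂ , isDirectSum))
      where
      M₁ : Matroid (cl p)
      M₁ = uniform₁ (cl p) (p , p∈cl[p] p)
      M₂ : Matroid (∁ (cl p))
      M₂ = uniform₁ (∁ (cl p)) (q , x∉p⇒x∈∁p λ q∈ → ∈-cl⁻ q∈ pq)
      ∉cl[p]⇒∈cl[q] : ∀ {x} → x ∉ cl p → x ∈ cl q
      ∉cl[p]⇒∈cl[q] x∉ = ∈-cl⁺ λ qx → ∄r (_ , ∉-cl⁻ x∉ , qx)
      split : ∀ {B} → Base B → ∃₂ λ B₁ B₂ →
        (∃[ x ] x ∈ cl p × B₁ ≡ ⁅ x ⁆) × (∃[ y ] y ∈ ∁ (cl p) × B₂ ≡ ⁅ y ⁆) × B ≡ B₁ ∪ B₂
      split b with x , y , xy , refl ← base⇒∃⋈ b with x ∈? cl p | y ∈? cl p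
      ... | yes x∈ | yes y∈ = contradiction xy (∥-trans x∈ y∈)
      ... | yes x∈ | no y∉  = ⁅ x ⁆ , ⁅ y ⁆ , (x , x∈ , refl) , (y , x∉p⇒x∈∁p y∉ , refl) , refl
      ... | no x∉  | yes y∈ = ⁅ y ⁆ , ⁅ x ⁆ , (y , y∈ , refl) , (x , x∉p⇒x∈∁p x∉ , refl) , ∪-comm ⁅ x ⁆ ⁅ y ⁆
      ... | no x∉  | no y∉  = contradiction xy (∥-trans (∉cl[p]⇒∈cl[q] x∉) (∉cl[p]⇒∈cl[q] y∉))
      isDirectSum : IsDirectSum M M₁ M₂
      isDirectSum = record
        { union    = p∪∁p≡⊤ (cl p)
        ; disjoint = ∩-inverseʳ (cl p)
        ; bases    = λ B → mk⇔ split
            (λ { (_ , _ , (x , x∈ , refl) , (y , y∈ , refl) , refl) → ⋈-∥ (∉-cl⁻ (x∈∁p⇒x∉p y∈)) x∈ })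
        }

    module Classes {s} (H : Enumeration (IsHyperplane M) s) where
      open Enumeration H

      class : Fin n → Fin s
      class p = proj₁ (complete (cl-isHyperplane p))

      element-class : ∀ p → element (class p) ≡ cl p
      element-class p = proj₂ (complete (cl-isHyperplane p))

      ∈-element⁺ : ∀ p → p ∈ element (class p)
      ∈-element⁺ p = subst (p ∈_) (sym (element-class p)) (p∈cl[p] p)

      ∈-element⁻ : ∀ {p i} → p ∈ element i → class p ≡ i
      ∈-element⁻ {p} {i} p∈ = injective (trans (element-class p) (sym (hyperplane≡cl (sound i) p∈)))

      class≢⇒⋈ : ∀ {p q} → class p ≢ class q → p ⋈ q
      class≢⇒⋈ {p} {q} c≢ = ∉-cl⁻ λ q∈ → c≢ (sym (∈-element⁻ (subst (q ∈_) (sym (element-class p)) q∈)))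

      ⋈⇒class≢ : ∀ {p q} → p ⋈ q → class p ≢ class q
      ⋈⇒class≢ {p} {q} pq c≡ = ∈-cl⁻ (subst (q ∈_) (trans (cong element (sym c≡)) (element-class p)) (∈-element⁺ q)) pq

      -- Strictness keeps k < n in every summand of `P`, so that the factor C(n - k - 1, n - k)
      -- makes it vanish at t = 0.
      ∣element∣<n : ∀ i → ∣ element i ∣ < n
      ∣element∣<n i =
        let p , p∈ = hyperplane-nonempty (sound i) ; q , pq = loopless p
        in subst (∣ element i ∣ <_) (∣⊤∣≡n n) (p⊂q⇒∣p∣<∣q∣
             (⊆⊤ , q , ∈⊤ , λ q∈ → ⋈⇒class≢ pq (trans (∈-element⁻ p∈) (sym (∈-element⁻ q∈)))))

      3≤s : Connected M → s ≥ 3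
      3≤s conn =
        let p , q , pq , _ = base⇒∃⋈ (proj₂ nonempty) ; r , pr , qr = connected⇒thirdClass conn pq
        in injective⇒≤ (threeClasses-injective p q r pq pr qr)
        where
        threeClasses : (p q r : Fin n) → Fin 3 → Fin s
        threeClasses p q r 0F = class p
        threeClasses p q r 1F = class q
        threeClasses p q r 2F = class r
        threeClasses-injective : ∀ p q r → p ⋈ q → p ⋈ r → q ⋈ r →
          ∀ {i j} → threeClasses p q r i ≡ threeClasses p q r j → i ≡ j
        threeClasses-injective p q r pq pr qr {0F} {0F} _ = refl
        threeClasses-injective p q r pq pr qr {0F} {1F} e = contradiction e (⋈⇒class≢ pq)
        threeClasses-injective p q r pq pr qr {0F} {2F} e = contradiction e (⋈⇒class≢ pr)
        threeClasses-injective p q r pq pr qr {1F} {0F} e = contradiction (sym e) (⋈⇒class≢ pq)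
        threeClasses-injective p q r pq pr qr {1F} {1F} _ = refl
        threeClasses-injective p q r pq pr qr {1F} {2F} e = contradiction e (⋈⇒class≢ qr)
        threeClasses-injective p q r pq pr qr {2F} {0F} e = contradiction (sym e) (⋈⇒class≢ pr)
        threeClasses-injective p q r pq pr qr {2F} {1F} e = contradiction (sym e) (⋈⇒class≢ qr)
        threeClasses-injective p q r pq pr qr {2F} {2F} _ = refl

-- Weights of the parallel classes

χ : Subset n → Fin n → ℕ
χ A p = if lookup A p then 1 else 0

χ-∈ : ∀ {A : Subset n} {p} → p ∈ A → χ A p ≡ 1
χ-∈ p∈A = cong (if_then 1 else 0) (Vecₚ.[]=⇒lookup p∈A)

χ-∉ : ∀ {A : Subset n} {p} → p ∉ A → χ A p ≡ 0
χ-∉ {A = A} {p} p∉A with lookup A p in eq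
... | true  = contradiction (Vecₚ.lookup⇒[]= p A eq) p∉A
... | false = refl

χ-∪ : ∀ (A B : Subset n) → (∀ {x} → x ∈ A → x ∉ B) → ∀ p → χ (A ∪ B) p ≡ χ A p + χ B p
χ-∪ A B A∩B≡∅ p with p ∈? A | p ∈? B
... | yes p∈A | yes p∈B = contradiction p∈B (A∩B≡∅ p∈A)
... | yes p∈A | no p∉B = trans (χ-∈ (x∈p∪q⁺ {p = A} {B} (inj₁ p∈A))) (sym (cong₂ _+_ (χ-∈ p∈A) (χ-∉ p∉B)))
... | no p∉A | yes p∈B = trans (χ-∈ (x∈p∪q⁺ {p = A} {B} (inj₂ p∈B))) (sym (cong₂ _+_ (χ-∉ p∉A) (χ-∈ p∈B)))
... | no p∉A | no p∉B = trans (χ-∉ {A = A ∪ B} (λ p∈ → absurd (x∈p∪q⁻ A B p∈))) (sym (cong₂ _+_ (χ-∉ p∉A) (χ-∉ p∉B)))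
  where
  absurd : ¬ (p ∈ A ⊎ p ∈ B)
  absurd (inj₁ p∈A) = p∉A p∈A
  absurd (inj₂ p∈B) = p∉B p∈B

inc : Fin n → Vec ℕ n → Vec ℕ n
inc p z = updateAt z p suc

wt-inc : ∀ (A : Subset n) p z → wt A (inc p z) ≡ χ A p + wt A z
wt-inc (inside ∷ A)  zero    (x ∷ z) = refl
wt-inc (outside ∷ A) zero    (x ∷ z) = refl
wt-inc (inside ∷ A)  (suc p) (x ∷ z) rewrite wt-inc A p z =
  solve 3 (λ a b c → a :+ (b :+ c) := b :+ (a :+ c)) refl x (χ A p) (wt A z)
  where open +-*-Solver
wt-inc (outside ∷ A) (suc p) (x ∷ z) = wt-inc A p z

lookup-inc : ∀ p (z : Vec ℕ n) i → lookup (inc p z) i ≡ χ ⁅ p ⁆ i + lookup z i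
lookup-inc p z i with i ≟ p
... | yes refl = trans (Vecₚ.lookup∘updateAt i z) (cong (_+ lookup z i) (sym (χ-∈ (x∈⁅x⁆ i))))
... | no  i≢p  = trans (Vecₚ.lookup∘updateAt′ i p i≢p z) (cong (_+ lookup z i) (sym (χ-∉ (x≢y⇒x∉⁅y⁆ i≢p))))

wt⊤≡0⇒lookup≡0 : ∀ (z : Vec ℕ n) → wt ⊤ z ≡ 0 → ∀ i → lookup z i ≡ 0
wt⊤≡0⇒lookup≡0 (x ∷ z) eq zero    = m+n≡0⇒m≡0 x eq
wt⊤≡0⇒lookup≡0 (x ∷ z) eq (suc i) = wt⊤≡0⇒lookup≡0 z (m+n≡0⇒n≡0 x eq) i

abstract
  0<wt⇒inc : ∀ (A : Subset n) z → 0 < wt A z → ∃₂ λ p z′ → p ∈ A × z ≡ inc p z′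
  0<wt⇒inc []            []          ()
  0<wt⇒inc (inside ∷ A)  (suc x ∷ z) h = zero , x ∷ z , here , refl
  0<wt⇒inc (inside ∷ A)  (zero ∷ z)  h =
    let p , z′ , p∈A , eq = 0<wt⇒inc A z h in suc p , zero ∷ z′ , there p∈A , cong (zero ∷_) eq
  0<wt⇒inc (outside ∷ A) (x ∷ z)     h =
    let p , z′ , p∈A , eq = 0<wt⇒inc A z h in suc p , x ∷ z′ , there p∈A , cong (x ∷_) eq

wt-∁ : ∀ (A : Subset n) z → wt A z + wt (∁ A) z ≡ wt ⊤ z
wt-∁ []            []      = refl
wt-∁ (inside ∷ A)  (x ∷ z) = trans (+-assoc x _ _) (cong (x +_) (wt-∁ A z))
wt-∁ (outside ∷ A) (x ∷ z) rewrite sym (wt-∁ A z) =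
  solve 3 (λ a b c → a :+ (b :+ c) := b :+ (a :+ c)) refl (wt A z) x (wt (∁ A) z)
  where open +-*-Solver

-- Allowing any common superset `D` makes the bound applicable inside the complement of a third
-- class.
wt-disjoint : ∀ (A B D : Subset n) z → A ⊆ D → B ⊆ D → (∀ {x} → x ∈ A → x ∉ B) → wt A z + wt B z ≤ wt D z
wt-disjoint []            []            []            []      _ _ _ = z≤n
wt-disjoint (inside ∷ A)  (inside ∷ B)  (_ ∷ D)       (x ∷ z) _ _ d = contradiction here (d here)
wt-disjoint (inside ∷ A)  (outside ∷ B) (inside ∷ D)  (x ∷ z) a b d =
  ≤-trans (≤-reflexive (+-assoc x _ _)) (+-monoʳ-≤ x (wt-disjoint A B D z (drop-∷-⊆ a) (drop-∷-⊆ b) (λ i j → d (there i) (there j))))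
wt-disjoint (inside ∷ A)  (outside ∷ B) (outside ∷ D) (x ∷ z) a b d = contradiction (a here) λ ()
wt-disjoint (outside ∷ A) (inside ∷ B)  (inside ∷ D)  (x ∷ z) a b d =
  ≤-trans (≤-reflexive (solve 3 (λ a x b → a :+ (x :+ b) := x :+ (a :+ b)) refl (wt A z) x (wt B z)))
    (+-monoʳ-≤ x (wt-disjoint A B D z (drop-∷-⊆ a) (drop-∷-⊆ b) (λ i j → d (there i) (there j))))
  where open +-*-Solver
wt-disjoint (outside ∷ A) (inside ∷ B)  (outside ∷ D) (x ∷ z) a b d = contradiction (b here) λ ()
wt-disjoint (outside ∷ A) (outside ∷ B) (inside ∷ D)  (x ∷ z) a b d =
  ≤-trans (wt-disjoint A B D z (drop-∷-⊆ a) (drop-∷-⊆ b) (λ i j → d (there i) (there j))) (m≤n+m _ x)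
wt-disjoint (outside ∷ A) (outside ∷ B) (outside ∷ D) (x ∷ z) a b d =
  wt-disjoint A B D z (drop-∷-⊆ a) (drop-∷-⊆ b) (λ i j → d (there i) (there j))

abstract
  maximizer : ∀ {s} (w : Fin s → ℕ) {ℓ} {P : Pred (Fin s) ℓ} → Decidable P → ∀ i₀ → P i₀ →
    ∃[ i ] P i × (∀ {j} → P j → w j ≤ w i)
  maximizer {s} w P? i₀ Pi₀ =
    argmax w i₀ candidates ,
    argmax-all w Pi₀ (Allₚ.all-filter P? (allFin s)) ,
    λ {j} Pj → All.lookup (f[xs]≤f[argmax] i₀ candidates) (∈ₚ.∈-filter⁺ P? (∈ₚ.∈-allFin j) Pj)
    where
    candidates : List (Fin s)
    candidates = filter P? (allFin s)

-- Decomposition and counting depend only on how the ground set is partitioned into classes, so the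
-- matroid is left behind here.
module Partition {n s} (H : Fin s → Subset n) (class : Fin n → Fin s)
  (∈H⁺ : ∀ p → p ∈ H (class p)) (∈H⁻ : ∀ {p i} → p ∈ H i → class p ≡ i) where

  H-disjoint : ∀ {i j} → i ≢ j → ∀ {p} → p ∈ H i → p ∉ H j
  H-disjoint i≢j p∈i p∈j = i≢j (trans (sym (∈H⁻ p∈i)) (∈H⁻ p∈j))

  0<wt-class : ∀ p z → 0 < wt (H (class p)) (inc p z)
  0<wt-class p z = subst (0 <_) (sym (trans (wt-inc (H (class p)) p z) (cong (_+ wt (H (class p)) z) (χ-∈ (∈H⁺ p))))) z<s

  -- The field `others` keeps the induction going: the classes of `p` and `q` drop by one from at
  -- most t + 1, so the remaining classes must already have weight at most t.
  record Removable (t : ℕ) (z : Vec ℕ n) : Set where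
    field
      p q      : Fin n
      rest     : Vec ℕ n
      distinct : class p ≢ class q
      restores : z ≡ inc p (inc q rest)
      others   : ∀ {i} → i ≢ class p → i ≢ class q → wt (H i) z ≤ t

  heaviest : ∀ {ℓ} {P : Pred (Fin s) ℓ} (P? : Decidable P) A → (∀ {p} → p ∈ A → P (class p)) → ∀ z → 0 < wt A z →
    ∃[ i ] P i × 0 < wt (H i) z × (∀ {j} → P j → wt (H j) z ≤ wt (H i) z)
  heaviest P? A A⇒P z 0<wt =
    let p , z′ , p∈A , z≡ = 0<wt⇒inc A z 0<wt
        i , Pi , i-max = maximizer (λ i → wt (H i) z) P? (class p) (A⇒P p∈A)
    in i , Pi , ≤-trans (subst (λ v → 0 < wt (H (class p)) v) (sym z≡) (0<wt-class p z′)) (i-max (A⇒P p∈A)) , i-max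

  three-classes : ∀ {i j k} → i ≢ j → i ≢ k → j ≢ k → ∀ z → wt (H i) z + (wt (H j) z + wt (H k) z) ≤ wt ⊤ z
  three-classes {i} {j} {k} i≢j i≢k j≢k z = ≤-trans
    (+-monoʳ-≤ (wt (H i) z) (wt-disjoint (H j) (H k) (∁ (H i)) z
      (x∉p⇒x∈∁p ∘ H-disjoint (i≢j ∘ sym)) (x∉p⇒x∈∁p ∘ H-disjoint (i≢k ∘ sym)) (H-disjoint j≢k)))
    (≤-reflexive (wt-∁ (H i) z))

  remove : ∀ {t i j} z → i ≢ j → 0 < wt (H i) z → 0 < wt (H j) z →
    (∀ {k} → k ≢ i → k ≢ j → wt (H k) z ≤ t) → Removable t z
  remove {t} {i} {j} z i≢j 0<i 0<j others
    with p , z′ , p∈ , refl ← 0<wt⇒inc (H i) z 0<i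
    with q , z″ , q∈ , refl ← 0<wt⇒inc (H j) z′ (subst (0 <_)
           (trans (wt-inc (H j) p z′) (cong (_+ wt (H j) z′) (χ-∉ (H-disjoint i≢j p∈)))) 0<j)
    with refl ← ∈H⁻ p∈ | refl ← ∈H⁻ q∈ =
    record { p = p ; q = q ; rest = z″ ; distinct = i≢j ; restores = refl ; others = others }

  -- Remove one element from each of two heaviest classes: a third class of
  -- weight t + 1 would force a total of at least 3 (t + 1).
  removable : ∀ t z → wt ⊤ z ≡ suc t + suc t → (∀ i → wt (H i) z ≤ suc t) → Removable t z
  removable t z total≡ w≤ =
    let i , _ , 0<i , i-max = heaviest (λ k → yes k) ⊤ (λ {p} _ → class p) z (subst (0 <_) (sym total≡) z<s)
        j , j≢i , 0<j , j-max = heaviest (λ k → ¬? (k ≟ i)) (∁ (H i))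
          (λ {p} p∈ c≡ → x∈∁p⇒x∉p p∈ (subst (λ k → p ∈ H k) c≡ (∈H⁺ p))) z (0<∁ i)
    in remove z (j≢i ∘ sym) 0<i 0<j λ {k} k≢i k≢j → ≮⇒≥ λ t<k → <⇒≱
         (three t<k (≤-trans t<k (j-max k≢i)) (≤-trans t<k (i-max k)))
         (≤-trans (three-classes (j≢i ∘ sym) (k≢i ∘ sym) (k≢j ∘ sym) z) (≤-reflexive total≡))
    where
    -- A class holds at most t + 1 of the total 2 (t + 1), so at least t + 1 lies outside it and a
    -- second class can be found.
    0<∁ : ∀ i → 0 < wt (∁ (H i)) z
    0<∁ i = ≤-trans z<s (+-cancelˡ-≤ (suc t) (suc t) _
      (≤-trans (≤-reflexive (trans (sym total≡) (sym (wt-∁ (H i) z)))) (+-monoˡ-≤ _ (w≤ i))))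
    three : ∀ {a b c} → t < a → t < b → t < c → suc t + suc t < c + (b + a)
    three t<a t<b t<c = ≤-trans (s≤s (m≤n+m (suc t + suc t) t)) (+-mono-≤ t<c (+-mono-≤ t<b t<a))

  record Decomposition (t : ℕ) (z : Vec ℕ n) : Set where
    field
      p q      : Fin t → Fin n
      distinct : ∀ j → class (p j) ≢ class (q j)
      expand   : ∀ i → lookup z i ≡ VF.foldr _+_ 0 (λ j → χ (⁅ p j ⁆ ∪ ⁅ q j ⁆) i)

  module _ {t z} (r : Removable t z) where
    open Removable r

    wt-rest : ∀ A → wt A z ≡ χ A p + (χ A q + wt A rest)
    wt-rest A = trans (cong (wt A) restores) (trans (wt-inc A p (inc q rest)) (cong (χ A p +_) (wt-inc A q rest)))

    total-rest : wt ⊤ z ≡ suc t + suc t → wt ⊤ rest ≡ t + t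
    total-rest total≡ = suc-injective (suc-injective (trans (sym (trans (wt-rest ⊤)
      (cong₂ (λ a b → a + (b + wt ⊤ rest)) (χ-∈ (∈⊤ {x = p})) (χ-∈ (∈⊤ {x = q}))))) (trans total≡ (cong suc (+-suc t t)))))

    light-rest : (∀ i → wt (H i) z ≤ suc t) → ∀ i → wt (H i) rest ≤ t
    light-rest w≤ i with i ≟ class p | i ≟ class q
    ... | yes refl | _ = ≤-trans (m≤n+m _ (χ (H i) q)) (s≤s⁻¹ (≤-trans (≤-reflexive
            (sym (trans (wt-rest (H i)) (cong (_+ (χ (H i) q + wt (H i) rest)) (χ-∈ (∈H⁺ p)))))) (w≤ i)))
    ... | no _ | yes refl = s≤s⁻¹ (≤-trans (≤-trans (≤-reflexive (cong (_+ wt (H i) rest) (sym (χ-∈ (∈H⁺ q)))))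
            (m≤n+m _ (χ (H i) p))) (≤-trans (≤-reflexive (sym (wt-rest (H i)))) (w≤ i)))
    ... | no i≢p | no i≢q = ≤-trans (≤-trans (m≤n+m _ (χ (H i) q)) (m≤n+m _ (χ (H i) p)))
            (≤-trans (≤-reflexive (sym (wt-rest (H i)))) (others i≢p i≢q))

    prepend : Decomposition t rest → Decomposition (suc t) z
    prepend d = record
      { p        = p VF.∷ D.p
      ; q        = q VF.∷ D.q
      ; distinct = λ { zero → distinct ; (suc j) → D.distinct j }
      ; expand   = expand
      }
      where
      module D = Decomposition d
      open ≡-Reasoning
      expand : ∀ i → lookup z i ≡ χ (⁅ p ⁆ ∪ ⁅ q ⁆) i + VF.foldr _+_ 0 (λ j → χ (⁅ D.p j ⁆ ∪ ⁅ D.q j ⁆) i)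
      expand i = begin
        lookup z i                                          ≡⟨ cong (λ v → lookup v i) restores ⟩
        lookup (inc p (inc q rest)) i                       ≡⟨ lookup-inc p (inc q rest) i ⟩
        χ ⁅ p ⁆ i + lookup (inc q rest) i                   ≡⟨ cong (χ ⁅ p ⁆ i +_) (lookup-inc q rest i) ⟩
        χ ⁅ p ⁆ i + (χ ⁅ q ⁆ i + lookup rest i)             ≡⟨ +-assoc (χ ⁅ p ⁆ i) _ _ ⟨
        χ ⁅ p ⁆ i + χ ⁅ q ⁆ i + lookup rest i               ≡⟨ cong₂ _+_ (sym (χ-∪ ⁅ p ⁆ ⁅ q ⁆
          (λ x∈p x∈q → distinct (cong class (trans (sym (x∈⁅y⁆⇒x≡y p x∈p)) (x∈⁅y⁆⇒x≡y q x∈q)))) i)) (D.expand i) ⟩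
        χ (⁅ p ⁆ ∪ ⁅ q ⁆) i + VF.foldr _+_ 0 (λ j → χ (⁅ D.p j ⁆ ∪ ⁅ D.q j ⁆) i) ∎

  abstract
    decompose : ∀ t z → wt ⊤ z ≡ t + t → (∀ i → wt (H i) z ≤ t) → Decomposition t z
    decompose zero    z total≡ w≤ = record
      { p = λ () ; q = λ () ; distinct = λ () ; expand = wt⊤≡0⇒lookup≡0 z total≡ }
    decompose (suc t) z total≡ w≤ =
      let r = removable t z total≡ w≤
      in prepend r (decompose t (Removable.rest r) (total-rest r total≡) (light-rest r w≤))

  light? : ∀ t → Decidable (λ (z : Vec ℕ n) → All (λ i → wt (H i) z ≤ t) (allFin s))
  light? t z = All.all? (λ i → wt (H i) z ≤? t) (allFin s)

  lightCompositions : ℕ → List (Vec ℕ n)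
  lightCompositions t = filter (light? t) (compositions n (t + t))

  length-lightCompositions : ∀ t →
    length (lightCompositions t) + sum (map (λ i → heavyCount (H i) t) (allFin s)) ≡ comp n (t + t)
  length-lightCompositions t = trans (count (compositions n (t + t)) (All.tabulate (λ z∈ → exclusive (∈-compositions⁻ n (t + t) z∈))))
    (length-compositions n (t + t))
    where
    exclusive : ∀ {z} → wt ⊤ z ≡ t + t → ∀ i j → t < wt (H i) z → t < wt (H j) z → i ≡ j
    exclusive {z} total≡ i j t<i t<j with i ≟ j
    ... | yes i≡j = i≡j
    ... | no  i≢j = contradiction
      (≤-trans (wt-disjoint (H i) (H j) ⊤ z (λ _ → ∈⊤) (λ _ → ∈⊤) (H-disjoint i≢j)) (≤-reflexive total≡))
      (<⇒≱ (+-mono-<-≤ t<i (<⇒≤ t<j)))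

    sum-map-+ : ∀ {A : Set} (f g : A → ℕ) l → sum (map (λ i → f i + g i) l) ≡ sum (map f l) + sum (map g l)
    sum-map-+ f g []      = refl
    sum-map-+ f g (i ∷ l) rewrite sum-map-+ f g l =
      solve 4 (λ a b c d → (a :+ b) :+ (c :+ d) := (a :+ c) :+ (b :+ d)) refl (f i) (g i) (sum (map f l)) (sum (map g l))
      where open +-*-Solver

    length-filter-∷ : ∀ {A : Set} {P : Pred A _} (P? : Decidable P) x l →
      length (filter P? (x ∷ l)) ≡ 𝟙 (P? x) + length (filter P? l)
    length-filter-∷ P? x l with P? x
    ... | yes _ = refl
    ... | no  _ = refl

    -- The classes are scanned in turn. One that is not heavy changes neither term; once a heavy one
    -- is met, `excl` makes all later indicators vanish.
    partition : ∀ (w : Fin s → ℕ) {l} → Unique l → (∀ i j → t < w i → t < w j → i ≡ j) →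
      𝟙 (All.all? (λ i → w i ≤? t) l) + sum (map (λ i → 𝟙 (t <? w i)) l) ≡ 1
    partition w []                   excl = refl
    partition w {i ∷ l} (i∉l ∷ uniq) excl with t <? w i
    ... | yes t<wi = cong₂ _+_
      (𝟙-no (All.all? (λ i → w i ≤? t) (i ∷ l)) (λ { (wi≤t ∷ _) → <⇒≱ t<wi wi≤t }))
      (cong suc (light-sum i∉l))
      where
      light-sum : ∀ {l} → All (i ≢_) l → sum (map (λ i → 𝟙 (t <? w i)) l) ≡ 0
      light-sum []                  = refl
      light-sum {j ∷ l} (i≢j ∷ i∉l) = cong₂ _+_ (𝟙-no (t <? w j) (i≢j ∘ excl i j t<wi)) (light-sum i∉l)
    ... | no t≮wi = trans (cong (_+ sum (map (λ i → 𝟙 (t <? w i)) l)) same) (partition w uniq excl)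
      where
      same : 𝟙 (All.all? (λ i → w i ≤? t) (i ∷ l)) ≡ 𝟙 (All.all? (λ i → w i ≤? t) l)
      same = 𝟙-cong (All.all? (λ i → w i ≤? t) (i ∷ l)) (All.all? (λ i → w i ≤? t) l) All.tail (≮⇒≥ t≮wi ∷_)

    heavy : Vec ℕ n → Fin s → ℕ
    heavy z i = 𝟙 (t <? wt (H i) z)

    count : ∀ l → All (λ z → ∀ i j → t < wt (H i) z → t < wt (H j) z → i ≡ j) l →
      length (filter (light? t) l) + sum (map (λ i → sum (map (λ z → heavy z i) l)) (allFin s)) ≡ length l
    count []      []             = sum-zero (allFin s)
      where
      sum-zero : ∀ (l : List (Fin s)) → sum (map (λ _ → 0) l) ≡ 0
      sum-zero []      = refl
      sum-zero (_ ∷ l) = sum-zero l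
    count (z ∷ l) (excl ∷ excls) = begin
      length (filter (light? t) (z ∷ l)) + sum (map (λ i → heavy z i + rest i) (allFin s))
        ≡⟨ cong₂ _+_ (length-filter-∷ (light? t) z l) (sum-map-+ (heavy z) rest (allFin s)) ⟩
      (𝟙 (light? t z) + length (filter (light? t) l)) + (sum (map (heavy z) (allFin s)) + sum (map rest (allFin s)))
        ≡⟨ solve 4 (λ a b c d → (a :+ b) :+ (c :+ d) := (a :+ c) :+ (b :+ d)) refl
             (𝟙 (light? t z)) (length (filter (light? t) l)) (sum (map (heavy z) (allFin s))) (sum (map rest (allFin s))) ⟩
      (𝟙 (light? t z) + sum (map (heavy z) (allFin s))) + (length (filter (light? t) l) + sum (map rest (allFin s)))
        ≡⟨ cong₂ _+_ (partition (λ i → wt (H i) z) (Uniqueₚ.allFin⁺ s) excl) (count l excls) ⟩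
      suc (length l) ∎
      where
      open ≡-Reasoning
      open +-*-Solver
      rest : Fin s → ℕ
      rest i = sum (map (λ z → heavy z i) l)

-- Evaluation of the polynomials

open import Data.Integer as ℤ using (ℤ; +_)
import Data.Integer.Properties as ℤₚ
import Data.Integer.Solver as ℤSolver
open import Data.Rational as ℚ using (ℚ; 0ℚ; 1ℚ)
import Data.Rational.Properties as ℚₚ
import Data.Rational.Solver as ℚSolver
open import Data.Rational.Unnormalised as ℚᵘ using (mkℚᵘ; *≡*; *≤*)
import Data.Rational.Unnormalised.Properties as ℚᵘₚ

-- Rationals are reduced fractions, and the reduction is stuck on variables. The identity is checked
-- on unnormalised fractions, where the denominator 1 stays visible.
ℤ→ℚ-homo-+ : ∀ a b → ℤ→ℚ (a ℤ.+ b) ≡ ℤ→ℚ a ℚ.+ ℤ→ℚ b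
ℤ→ℚ-homo-+ a b = ℚₚ.toℚᵘ-injective (begin
  ℚ.toℚᵘ (ℤ→ℚ (a ℤ.+ b))                 ≈⟨ ℚₚ.toℚᵘ-fromℚᵘ (mkℚᵘ (a ℤ.+ b) 0) ⟩
  mkℚᵘ (a ℤ.+ b) 0                       ≈⟨ *≡* (cong (ℤ._* + 1) (cong₂ ℤ._+_ (sym (ℤₚ.*-identityʳ a)) (sym (ℤₚ.*-identityʳ b)))) ⟩
  mkℚᵘ a 0 ℚᵘ.+ mkℚᵘ b 0                 ≈⟨ ℚᵘₚ.+-cong (ℚₚ.toℚᵘ-fromℚᵘ (mkℚᵘ a 0)) (ℚₚ.toℚᵘ-fromℚᵘ (mkℚᵘ b 0)) ⟨
  ℚ.toℚᵘ (ℤ→ℚ a) ℚᵘ.+ ℚ.toℚᵘ (ℤ→ℚ b)     ≈⟨ ℚₚ.toℚᵘ-homo-+ (ℤ→ℚ a) (ℤ→ℚ b) ⟨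
  ℚ.toℚᵘ (ℤ→ℚ a ℚ.+ ℤ→ℚ b)               ∎)
  where open ℚᵘₚ.≃-Reasoning

ℤ→ℚ-homo-* : ∀ a b → ℤ→ℚ (a ℤ.* b) ≡ ℤ→ℚ a ℚ.* ℤ→ℚ b
ℤ→ℚ-homo-* a b = ℚₚ.toℚᵘ-injective (begin
  ℚ.toℚᵘ (ℤ→ℚ (a ℤ.* b))                 ≈⟨ ℚₚ.toℚᵘ-fromℚᵘ (mkℚᵘ (a ℤ.* b) 0) ⟩
  mkℚᵘ a 0 ℚᵘ.* mkℚᵘ b 0                 ≈⟨ ℚᵘₚ.*-cong (ℚₚ.toℚᵘ-fromℚᵘ (mkℚᵘ a 0)) (ℚₚ.toℚᵘ-fromℚᵘ (mkℚᵘ b 0)) ⟨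
  ℚ.toℚᵘ (ℤ→ℚ a) ℚᵘ.* ℚ.toℚᵘ (ℤ→ℚ b)     ≈⟨ ℚₚ.toℚᵘ-homo-* (ℤ→ℚ a) (ℤ→ℚ b) ⟨
  ℚ.toℚᵘ (ℤ→ℚ a ℚ.* ℤ→ℚ b)               ∎)
  where open ℚᵘₚ.≃-Reasoning

ℕ→ℚ-homo-+ : ∀ a b → ℕ→ℚ (a + b) ≡ ℕ→ℚ a ℚ.+ ℕ→ℚ b
ℕ→ℚ-homo-+ a b = ℤ→ℚ-homo-+ (+ a) (+ b)

ℕ→ℚ-homo-* : ∀ a b → ℕ→ℚ (a * b) ≡ ℕ→ℚ a ℚ.* ℕ→ℚ b
ℕ→ℚ-homo-* a b = trans (cong ℤ→ℚ (ℤₚ.pos-* a b)) (ℤ→ℚ-homo-* (+ a) (+ b))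

1/k*k≡1 : ∀ k .{{_ : NonZero k}} → (+ 1 ℚ./ k) ℚ.* ℕ→ℚ k ≡ 1ℚ
1/k*k≡1 (suc k) = ℚₚ.toℚᵘ-injective (begin
  ℚ.toℚᵘ ((+ 1 ℚ./ suc k) ℚ.* ℕ→ℚ (suc k))                ≈⟨ ℚₚ.toℚᵘ-homo-* (+ 1 ℚ./ suc k) (ℕ→ℚ (suc k)) ⟩
  ℚ.toℚᵘ (+ 1 ℚ./ suc k) ℚᵘ.* ℚ.toℚᵘ (ℕ→ℚ (suc k))        ≈⟨ ℚᵘₚ.*-cong (ℚₚ.toℚᵘ-fromℚᵘ (mkℚᵘ (+ 1) k)) (ℚₚ.toℚᵘ-fromℚᵘ (mkℚᵘ (+ suc k) 0)) ⟩
  mkℚᵘ (+ 1) k ℚᵘ.* mkℚᵘ (+ suc k) 0                       ≈⟨ *≡* (cong ℤ.+_ (cong suc (trans (*-identityʳ (k + 0)) (cong (_+ 0) (sym (*-identityʳ k)))))) ⟩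
  ℚ.toℚᵘ 1ℚ                                               ∎)
  where open ℚᵘₚ.≃-Reasoning

module _ where
  open ℚSolver.+-*-Solver

  eval-+ᵖ : ∀ p q x → eval (p +ᵖ q) x ≡ eval p x ℚ.+ eval q x
  eval-+ᵖ []      q       x = sym (ℚₚ.+-identityˡ (eval q x))
  eval-+ᵖ (a ∷ p) []      x = sym (ℚₚ.+-identityʳ (eval (a ∷ p) x))
  eval-+ᵖ (a ∷ p) (b ∷ q) x rewrite eval-+ᵖ p q x =
    solve 5 (λ a b x p q → (a :+ b) :+ x :* (p :+ q) := (a :+ x :* p) :+ (b :+ x :* q)) refl a b x (eval p x) (eval q x)

  eval-·ᵖ : ∀ a p x → eval (a ·ᵖ p) x ≡ a ℚ.* eval p x
  eval-·ᵖ a []      x = sym (ℚₚ.*-zeroʳ a)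
  eval-·ᵖ a (b ∷ p) x rewrite eval-·ᵖ a p x =
    solve 4 (λ a b x p → a :* b :+ x :* (a :* p) := a :* (b :+ x :* p)) refl a b x (eval p x)

  eval--ᵖ : ∀ p q x → eval (p -ᵖ q) x ≡ eval p x ℚ.- eval q x
  eval--ᵖ p q x = trans (eval-+ᵖ p _ x) (cong (eval p x ℚ.+_) (trans (eval-·ᵖ (ℚ.- 1ℚ) q x)
    (solve 1 (λ q → :- con 1ℚ :* q := :- q) refl (eval q x))))

  eval-*ᵖ : ∀ p q x → eval (p *ᵖ q) x ≡ eval p x ℚ.* eval q x
  eval-*ᵖ []      q x = sym (ℚₚ.*-zeroˡ (eval q x))
  eval-*ᵖ (a ∷ p) q x rewrite eval-+ᵖ (a ·ᵖ q) (0ℚ ∷ p *ᵖ q) x | eval-·ᵖ a q x | eval-*ᵖ p q x =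
    solve 4 (λ a x p q → a :* q :+ (con 0ℚ :+ x :* (p :* q)) := (a :+ x :* p) :* q) refl a x (eval p x) (eval q x)

  eval-const : ∀ a x → eval (a ∷ []) x ≡ a
  eval-const a x = solve 2 (λ a x → a :+ x :* con 0ℚ := a) refl a x

  falling : ℚ → ℕ → ℚ
  falling y zero    = 1ℚ
  falling y (suc m) = falling y m ℚ.* (y ℚ.- ℕ→ℚ m)

  falling-suc : ∀ y m → falling (1ℚ ℚ.+ y) (suc m) ≡ (1ℚ ℚ.+ y) ℚ.* falling y m
  falling-suc y zero    = solve 1 (λ y → con 1ℚ :* ((con 1ℚ :+ y) :- con 0ℚ) := (con 1ℚ :+ y) :* con 1ℚ) refl y
  falling-suc y (suc m) = trans
    (cong₂ ℚ._*_ (falling-suc y m) (cong (λ k → (1ℚ ℚ.+ y) ℚ.- k) (ℕ→ℚ-homo-+ 1 m)))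
    (solve 3 (λ y f m → ((con 1ℚ :+ y) :* f) :* ((con 1ℚ :+ y) :- (con 1ℚ :+ m)) := (con 1ℚ :+ y) :* (f :* (y :- m)))
      refl y (falling y m) (ℕ→ℚ m))

  falling-zero : ∀ m → falling 0ℚ (suc m) ≡ 0ℚ
  falling-zero zero    = refl
  falling-zero (suc m) = trans (cong (ℚ._* (0ℚ ℚ.- ℕ→ℚ (suc m))) (falling-zero m)) (ℚₚ.*-zeroˡ (0ℚ ℚ.- ℕ→ℚ (suc m)))

  -- Pascal's rule multiplied by (m + 1)!. It comes from 1 + y = (y - m) + (1 + m).
  falling-pascal : ∀ y m → falling (1ℚ ℚ.+ y) (suc m) ≡ falling y (suc m) ℚ.+ ℕ→ℚ (suc m) ℚ.* falling y m
  falling-pascal y m = trans (falling-suc y m) (trans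
    (solve 3 (λ y f m → (con 1ℚ :+ y) :* f := f :* (y :- m) :+ (con 1ℚ :+ m) :* f) refl y (falling y m) (ℕ→ℚ m))
    (cong (λ k → falling y (suc m) ℚ.+ k ℚ.* falling y m) (sym (ℕ→ℚ-homo-+ 1 m))))

-- Both sides obey the same Pascal recursion. The case N < m, where both vanish, is the one that
-- matters at t = 0.
falling-C : ∀ N m → falling (ℕ→ℚ N) m ≡ ℕ→ℚ (m !) ℚ.* ℕ→ℚ (N C m)
falling-C N zero = refl
falling-C zero (suc m) = trans (falling-zero m) (sym (ℚₚ.*-zeroʳ (ℕ→ℚ (suc m !))))
falling-C (suc N) (suc m) = begin
  falling (ℕ→ℚ (suc N)) (suc m)
    ≡⟨ cong (λ y → falling y (suc m)) (ℕ→ℚ-homo-+ 1 N) ⟩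
  falling (1ℚ ℚ.+ ℕ→ℚ N) (suc m)
    ≡⟨ falling-pascal (ℕ→ℚ N) m ⟩
  falling (ℕ→ℚ N) (suc m) ℚ.+ ℕ→ℚ (suc m) ℚ.* falling (ℕ→ℚ N) m
    ≡⟨ cong₂ (λ x y → x ℚ.+ ℕ→ℚ (suc m) ℚ.* y) (falling-C N (suc m)) (falling-C N m) ⟩
  ℕ→ℚ (suc m !) ℚ.* ℕ→ℚ (N C suc m) ℚ.+ ℕ→ℚ (suc m) ℚ.* (ℕ→ℚ (m !) ℚ.* ℕ→ℚ (N C m))
    ≡⟨ cong (ℕ→ℚ (suc m !) ℚ.* ℕ→ℚ (N C suc m) ℚ.+_) (trans (sym (ℚₚ.*-assoc (ℕ→ℚ (suc m)) _ _))
         (cong (ℚ._* ℕ→ℚ (N C m)) (sym (ℕ→ℚ-homo-* (suc m) (m !))))) ⟩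
  ℕ→ℚ (suc m !) ℚ.* ℕ→ℚ (N C suc m) ℚ.+ ℕ→ℚ (suc m !) ℚ.* ℕ→ℚ (N C m)
    ≡⟨ ℚₚ.*-distribˡ-+ (ℕ→ℚ (suc m !)) _ _ ⟨
  ℕ→ℚ (suc m !) ℚ.* (ℕ→ℚ (N C suc m) ℚ.+ ℕ→ℚ (N C m))
    ≡⟨ cong (ℕ→ℚ (suc m !) ℚ.*_) (trans (ℚₚ.+-comm (ℕ→ℚ (N C suc m)) _) (trans (sym (ℕ→ℚ-homo-+ (N C m) (N C suc m)))
         (cong ℕ→ℚ (nCk+nC[k+1]≡[n+1]C[k+1] N m)))) ⟩
  ℕ→ℚ (suc m !) ℚ.* ℕ→ℚ (suc N C suc m) ∎
  where open ≡-Reasoning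

foldr-snoc-* : ∀ xs (x : ℚ) → foldr ℚ._*_ 1ℚ (xs ++ x ∷ []) ≡ foldr ℚ._*_ 1ℚ xs ℚ.* x
foldr-snoc-* []       x = trans (ℚₚ.*-identityʳ x) (sym (ℚₚ.*-identityˡ x))
foldr-snoc-* (y ∷ xs) x = trans (cong (y ℚ.*_) (foldr-snoc-* xs x)) (sym (ℚₚ.*-assoc y _ x))

foldr-falling : ∀ y m → foldr ℚ._*_ 1ℚ (map (λ i → y ℚ.- ℕ→ℚ i) (upTo m)) ≡ falling y m
foldr-falling y zero    = refl
foldr-falling y (suc m) = begin
  foldr ℚ._*_ 1ℚ (map (λ i → y ℚ.- ℕ→ℚ i) (upTo (suc m)))
    ≡⟨ cong (foldr ℚ._*_ 1ℚ ∘ map (λ i → y ℚ.- ℕ→ℚ i)) (Listₚ.upTo-∷ʳ m) ⟨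
  foldr ℚ._*_ 1ℚ (map (λ i → y ℚ.- ℕ→ℚ i) (upTo m ++ m ∷ []))
    ≡⟨ cong (foldr ℚ._*_ 1ℚ) (Listₚ.map-++ _ (upTo m) (m ∷ [])) ⟩
  foldr ℚ._*_ 1ℚ (map (λ i → y ℚ.- ℕ→ℚ i) (upTo m) ++ y ℚ.- ℕ→ℚ m ∷ [])
    ≡⟨ foldr-snoc-* (map (λ i → y ℚ.- ℕ→ℚ i) (upTo m)) _ ⟩
  foldr ℚ._*_ 1ℚ (map (λ i → y ℚ.- ℕ→ℚ i) (upTo m)) ℚ.* (y ℚ.- ℕ→ℚ m)
    ≡⟨ cong (ℚ._* (y ℚ.- ℕ→ℚ m)) (foldr-falling y m) ⟩
  falling y (suc m) ∎
  where open ≡-Reasoning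

eval-product : ∀ p x ms → eval (foldr _*ᵖ_ (1ℚ ∷ []) (map (λ i → p -ᵖ (ℕ→ℚ i ∷ [])) ms)) x ≡
                          foldr ℚ._*_ 1ℚ (map (λ i → eval p x ℚ.- ℕ→ℚ i) ms)
eval-product p x []       = eval-const 1ℚ x
eval-product p x (i ∷ ms) = trans (eval-*ᵖ (p -ᵖ (ℕ→ℚ i ∷ [])) _ x)
  (cong₂ ℚ._*_ (trans (eval--ᵖ p (ℕ→ℚ i ∷ []) x) (cong (λ k → eval p x ℚ.- k) (eval-const (ℕ→ℚ i) x))) (eval-product p x ms))

eval-binom : ∀ p m x {N} → eval p x ≡ ℕ→ℚ N → eval (binom p m) x ≡ ℕ→ℚ (N C m)
eval-binom p m x {N} p[x]≡N = begin
  eval (binom p m) x                                              ≡⟨ eval-·ᵖ (1/ m !) (foldr _*ᵖ_ (1ℚ ∷ []) (map (λ i → p -ᵖ (ℕ→ℚ i ∷ [])) (upTo m))) x ⟩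
  1/ m ! ℚ.* eval (foldr _*ᵖ_ (1ℚ ∷ []) (map (λ i → p -ᵖ (ℕ→ℚ i ∷ [])) (upTo m))) x ≡⟨ cong (1/ m ! ℚ.*_) (eval-product p x (upTo m)) ⟩
  1/ m ! ℚ.* foldr ℚ._*_ 1ℚ (map (λ i → eval p x ℚ.- ℕ→ℚ i) (upTo m)) ≡⟨ cong (1/ m ! ℚ.*_) (foldr-falling (eval p x) m) ⟩
  1/ m ! ℚ.* falling (eval p x) m                                 ≡⟨ cong (λ y → 1/ m ! ℚ.* falling y m) p[x]≡N ⟩
  1/ m ! ℚ.* falling (ℕ→ℚ N) m                                    ≡⟨ cong (1/ m ! ℚ.*_) (falling-C N m) ⟩
  1/ m ! ℚ.* (ℕ→ℚ (m !) ℚ.* ℕ→ℚ (N C m))                          ≡⟨ ℚₚ.*-assoc (1/ m !) _ _ ⟨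
  1/ m ! ℚ.* ℕ→ℚ (m !) ℚ.* ℕ→ℚ (N C m)                            ≡⟨ cong (ℚ._* ℕ→ℚ (N C m)) (1/k*k≡1 (m !) {{m !≢0}}) ⟩
  1ℚ ℚ.* ℕ→ℚ (N C m)                                              ≡⟨ ℚₚ.*-identityˡ _ ⟩
  ℕ→ℚ (N C m)                                                     ∎
  where open ≡-Reasoning

-- Stars and bars: `b` bars separate `suc b` parts.
comp-C : ∀ b u → comp (suc b) u ≡ (u + b) C b
comp-C zero    zero    = refl
comp-C zero    (suc u) = trans (+-identityʳ _) (comp-C zero u)
comp-C (suc b) zero    = sym (nCn≡1 (suc b))
comp-C (suc b) (suc u) = begin
  comp (suc (suc b)) u + comp (suc b) (suc u)   ≡⟨ cong₂ _+_ (comp-C (suc b) u) (comp-C b (suc u)) ⟩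
  (u + suc b) C suc b + (suc u + b) C b         ≡⟨ cong (λ N → (u + suc b) C suc b + N C b) (sym (+-suc u b)) ⟩
  (u + suc b) C suc b + (u + suc b) C b         ≡⟨ +-comm ((u + suc b) C suc b) _ ⟩
  (u + suc b) C b + (u + suc b) C suc b         ≡⟨ nCk+nC[k+1]≡[n+1]C[k+1] (u + suc b) b ⟩
  (suc u + suc b) C suc b                       ∎
  where open ≡-Reasoning

eval-linear : ∀ α c t {N} → c ℤ.+ α ℤ.* + t ≡ + N → eval (α t+ c) (ℕ→ℚ t) ≡ ℕ→ℚ N
eval-linear α c t {N} eq = begin
  ℤ→ℚ c ℚ.+ ℕ→ℚ t ℚ.* (ℤ→ℚ α ℚ.+ ℕ→ℚ t ℚ.* 0ℚ) ≡⟨ solve 3 (λ c t α → c :+ t :* (α :+ t :* con 0ℚ) := c :+ α :* t) refl (ℤ→ℚ c) (ℕ→ℚ t) (ℤ→ℚ α) ⟩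
  ℤ→ℚ c ℚ.+ ℤ→ℚ α ℚ.* ℕ→ℚ t                    ≡⟨ cong (ℤ→ℚ c ℚ.+_) (ℤ→ℚ-homo-* α (+ t)) ⟨
  ℤ→ℚ c ℚ.+ ℤ→ℚ (α ℤ.* + t)                    ≡⟨ ℤ→ℚ-homo-+ c (α ℤ.* + t) ⟨
  ℤ→ℚ (c ℤ.+ α ℤ.* + t)                        ≡⟨ cong ℤ→ℚ eq ⟩
  ℕ→ℚ N                                        ∎
  where
  open ≡-Reasoning
  open ℚSolver.+-*-Solver

eval-sum : ∀ {a} {A : Set a} (g : A → ℚ[t]) (h : A → ℕ) x {l} → All (λ i → eval (g i) x ≡ ℕ→ℚ (h i)) l →
           eval (foldr _+ᵖ_ [] (map g l)) x ≡ ℕ→ℚ (sum (map h l))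
eval-sum g h x []                  = refl
eval-sum g h x {i ∷ l} (eq ∷ eqs) = trans (eval-+ᵖ (g i) _ x)
  (trans (cong₂ ℚ._+_ eq (eval-sum g h x eqs)) (sym (ℕ→ℚ-homo-+ (h i) (sum (map h l)))))

private
  module _ where
    open ℤSolver.+-*-Solver

    const₁ : ∀ j m t → + (suc j + suc m) ℤ.- + suc j ℤ.- + 1 ℤ.+ + 1 ℤ.* + t ≡ + (m + t)
    const₁ j m t = solve 3 (λ j m t → ((con (+ 1) :+ j) :+ (con (+ 1) :+ m)) :- (con (+ 1) :+ j) :- con (+ 1) :+ con (+ 1) :* t := m :+ t)
      refl (+ j) (+ m) (+ t)

    const₂ : ∀ j t → + suc j ℤ.- + 1 ℤ.+ + 1 ℤ.* + t ≡ + (t + j)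
    const₂ j t = solve 2 (λ j t → (con (+ 1) :+ j) :- con (+ 1) :+ con (+ 1) :* t := t :+ j) refl (+ j) (+ t)

    const₃ : ∀ m t → + suc m ℤ.- + 1 ℤ.+ + 2 ℤ.* + t ≡ + (t + t + m)
    const₃ m t = solve 2 (λ m t → (con (+ 1) :+ m) :- con (+ 1) :+ con (+ 2) :* t := t :+ t :+ m) refl (+ m) (+ t)

eval-simplex : ∀ n t .{{_ : NonZero n}} →
  eval (binom ((+ 2) t+ (+ n ℤ.- + 1)) (n ∸ 1)) (ℕ→ℚ t) ≡ ℕ→ℚ (comp n (t + t))
eval-simplex (suc m) t = trans
  (eval-binom (+ 2 t+ (+ suc m ℤ.- + 1)) m (ℕ→ℚ t) (eval-linear (+ 2) (+ suc m ℤ.- + 1) t (const₃ m t)))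
  (cong ℕ→ℚ (sym (comp-C m (t + t))))

private
  -- Since `excess` is indexed by t with the evaluation at t + 1, the value at 0 has to be added; it
  -- is 0 because of the factor C(m, m + 1).
  excess₀ : ℕ → ℕ → ℕ → ℕ
  excess₀ N zero    j = 0
  excess₀ N (suc t) j = excess N t j

  C-excess : ∀ j m t → ((m + t) C (suc j + suc m ∸ suc j)) * ((t + j) C j) ≡ excess₀ (suc j + suc m) t j
  C-excess j m t rewrite m+n∸m≡n (suc j) (suc m) = go t
    where
    go : ∀ t → ((m + t) C suc m) * ((t + j) C j) ≡ excess₀ (suc j + suc m) t j
    go zero    rewrite k>n⇒nCk≡0 {m + 0} {suc m} (s≤s (≤-reflexive (+-identityʳ m))) = refl
    go (suc t) rewrite m+n∸m≡n (suc j) (suc m) = sym (cong₂ _*_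
      (trans (comp-C (suc m) t) (cong (_C suc m) (trans (+-suc t m) (trans (cong suc (+-comm t m)) (sym (+-suc m t))))))
      (comp-C j (suc t)))

  eval-P₀ : ∀ a n t → a < n → eval (P a n) (ℕ→ℚ t) ≡ ℕ→ℚ (sum (map (excess₀ n t) (upTo a)))
  eval-P₀ a n t a<n = eval-sum _ (excess₀ n t) (ℕ→ℚ t) (Allₚ.applyUpTo⁺₁ id a λ {j} j<a →
      -- As k = j + 1 ≤ a < n, the number m = n - k - 1 is natural, so both binomials are evaluated
      -- at natural numbers.
      term j (n ∸ suc (suc j)) (trans (+-suc (suc j) (n ∸ suc (suc j))) (m+[n∸m]≡n (≤-trans (s≤s j<a) a<n))))
    where
    term : ∀ j m → suc j + suc m ≡ n →
      eval (binom (+ 1 t+ (+ n ℤ.- + suc j ℤ.- + 1)) (n ∸ suc j) *ᵖ binom (+ 1 t+ (+ suc j ℤ.- + 1)) j) (ℕ→ℚ t)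
        ≡ ℕ→ℚ (excess₀ n t j)
    term j m refl = begin
      eval (B₁ *ᵖ B₂) (ℕ→ℚ t)                            ≡⟨ eval-*ᵖ B₁ B₂ (ℕ→ℚ t) ⟩
      eval B₁ (ℕ→ℚ t) ℚ.* eval B₂ (ℕ→ℚ t)                ≡⟨ cong₂ ℚ._*_
        (eval-binom (+ 1 t+ c₁) (n ∸ suc j) (ℕ→ℚ t) (eval-linear (+ 1) c₁ t (const₁ j m t)))
        (eval-binom (+ 1 t+ c₂) j (ℕ→ℚ t) (eval-linear (+ 1) c₂ t (const₂ j t))) ⟩
      ℕ→ℚ ((m + t) C (n ∸ suc j)) ℚ.* ℕ→ℚ ((t + j) C j)  ≡⟨ ℕ→ℚ-homo-* ((m + t) C (n ∸ suc j)) _ ⟨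
      ℕ→ℚ (((m + t) C (n ∸ suc j)) * ((t + j) C j))      ≡⟨ cong ℕ→ℚ (C-excess j m t) ⟩
      ℕ→ℚ (excess₀ n t j)                                ∎
      where
      open ≡-Reasoning
      c₁ = + n ℤ.- + suc j ℤ.- + 1
      c₂ = + suc j ℤ.- + 1
      B₁ = binom (+ 1 t+ c₁) (n ∸ suc j)
      B₂ = binom (+ 1 t+ c₂) j

-- For a = n and t = 0 this fails: the summand k = n has the factor C(t-1,0) = 1.
eval-P : ∀ {n} (A : Subset n) t → ∣ A ∣ < n → eval (P ∣ A ∣ n) (ℕ→ℚ t) ≡ ℕ→ℚ (heavyCount A t)
eval-P {n} A zero    ∣A∣<n = trans (eval-P₀ ∣ A ∣ n 0 ∣A∣<n) (cong ℕ→ℚ (trans (sum-zero (upTo ∣ A ∣)) (sym (heavyCount-zero A))))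
  where
  sum-zero : ∀ (l : List ℕ) → sum (map (λ _ → 0) l) ≡ 0
  sum-zero []      = refl
  sum-zero (_ ∷ l) = sum-zero l
eval-P {n} A (suc t) ∣A∣<n = trans (eval-P₀ ∣ A ∣ n (suc t) ∣A∣<n) (cong ℕ→ℚ (sym (heavyCount-suc A t)))

-- Lattice points of the dilated polytope

ℤ→ℚ-mono-≤ : ∀ {a b} → a ℤ.≤ b → ℤ→ℚ a ℚ.≤ ℤ→ℚ b
ℤ→ℚ-mono-≤ {a} {b} a≤b = ℚₚ.toℚᵘ-cancel-≤
  (ℚᵘₚ.≤-respˡ-≃ (ℚᵘₚ.≃-sym (ℚₚ.toℚᵘ-fromℚᵘ (mkℚᵘ a 0)))
    (ℚᵘₚ.≤-respʳ-≃ (ℚᵘₚ.≃-sym (ℚₚ.toℚᵘ-fromℚᵘ (mkℚᵘ b 0)))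
      (*≤* (subst₂ ℤ._≤_ (sym (ℤₚ.*-identityʳ a)) (sym (ℤₚ.*-identityʳ b)) a≤b))))

ℤ→ℚ-cancel-≤ : ∀ {a b} → ℤ→ℚ a ℚ.≤ ℤ→ℚ b → a ℤ.≤ b
ℤ→ℚ-cancel-≤ {a} {b} a≤b = subst₂ ℤ._≤_ (ℤₚ.*-identityʳ a) (ℤₚ.*-identityʳ b) (ℚᵘₚ.drop-*≤*
  (ℚᵘₚ.≤-respˡ-≃ (ℚₚ.toℚᵘ-fromℚᵘ (mkℚᵘ a 0))
    (ℚᵘₚ.≤-respʳ-≃ (ℚₚ.toℚᵘ-fromℚᵘ (mkℚᵘ b 0)) (ℚₚ.toℚᵘ-mono-≤ a≤b))))

-- A lattice point is at first an arbitrary integer vector, so its weights are integers until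
-- nonnegativity has been derived from the polytope.
wtℤ : ∀ {n} → Subset n → Vec ℤ n → ℤ
wtℤ []            []      = + 0
wtℤ (inside ∷ A)  (x ∷ z) = x ℤ.+ wtℤ A z
wtℤ (outside ∷ A) (x ∷ z) = wtℤ A z

wtℤ-⊥ : ∀ {n} (z : Vec ℤ n) → wtℤ ⊥ z ≡ + 0
wtℤ-⊥ []      = refl
wtℤ-⊥ (x ∷ z) = wtℤ-⊥ z

wtℤ-⁅⁆ : ∀ {n} i (z : Vec ℤ n) → wtℤ ⁅ i ⁆ z ≡ lookup z i
wtℤ-⁅⁆ zero    (x ∷ z) = trans (cong (λ y → x ℤ.+ y) (wtℤ-⊥ z)) (ℤₚ.+-identityʳ x)
wtℤ-⁅⁆ (suc i) (x ∷ z) = wtℤ-⁅⁆ i z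

wtℤ-map : ∀ {n} (A : Subset n) z → wtℤ A (Vec.map ℤ.+_ z) ≡ + wt A z
wtℤ-map []            []      = refl
wtℤ-map (inside ∷ A)  (x ∷ z) = cong (λ y → + x ℤ.+ y) (wtℤ-map A z)
wtℤ-map (outside ∷ A) (x ∷ z) = wtℤ-map A z

dot-wtℤ : ∀ {n} (A : Subset n) z → sumℚ (λ i → ℕ→ℚ (χ A i) ℚ.* ℤ→ℚ (lookup z i)) ≡ ℤ→ℚ (wtℤ A z)
dot-wtℤ []            []      = refl
dot-wtℤ (inside ∷ A)  (x ∷ z) = trans (cong₂ ℚ._+_ (ℚₚ.*-identityˡ (ℤ→ℚ x)) (dot-wtℤ A z)) (sym (ℤ→ℚ-homo-+ x (wtℤ A z)))
dot-wtℤ (outside ∷ A) (x ∷ z) = trans (cong₂ ℚ._+_ (ℚₚ.*-zeroˡ (ℤ→ℚ x)) (dot-wtℤ A z)) (ℚₚ.+-identityˡ (ℤ→ℚ (wtℤ A z)))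

dot-∩ : ∀ {n} (A B : Subset n) → sumℚ (λ i → ℕ→ℚ (χ A i) ℚ.* ℕ→ℚ (χ B i)) ≡ ℕ→ℚ ∣ A ∩ B ∣
dot-∩ []            []            = refl
dot-∩ (inside ∷ A)  (inside ∷ B)  = trans (cong (1ℚ ℚ.+_) (dot-∩ A B)) (sym (ℕ→ℚ-homo-+ 1 ∣ A ∩ B ∣))
dot-∩ (inside ∷ A)  (outside ∷ B) = trans (cong (0ℚ ℚ.+_) (dot-∩ A B)) (ℚₚ.+-identityˡ _)
dot-∩ (outside ∷ A) (inside ∷ B)  = trans (cong (0ℚ ℚ.+_) (dot-∩ A B)) (ℚₚ.+-identityˡ _)
dot-∩ (outside ∷ A) (outside ∷ B) = trans (cong (0ℚ ℚ.+_) (dot-∩ A B)) (ℚₚ.+-identityˡ _)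

seq-e : ∀ {n} (B : Subset n) i k → seq (e B i) k ≡ ℕ→ℚ (χ B i)
seq-e B i k with lookup B i
... | true  = refl
... | false = refl

∼⇒≈ : ∀ {x y} → seq x ∼ seq y → x ≈ y
∼⇒≈ x∼y = _∼_.tends x∼y

≗⇒≈ : ∀ {x y} → (∀ k → seq x k ≡ seq y k) → x ≈ y
≗⇒≈ {x} {y} x≗y = ∼⇒≈ {x} {y} (≗⇒∼ x≗y)

module _ {n} (M : Matroid (⊤ {n})) where
  open Matroid M

  module _ (z : Vec ℤ n) (t : ℕ) (z∈ : LatticePoint (dilate t (matroidPolytope M)) z) where

    -- The sign lets one transfer through the hull serve both directions: σ = 1 gives upper bounds
    -- and σ = -1 lower bounds. At a base the functional counts A ∩ B.
    signed-≤ : ∀ σ A {b} → (∀ {B} → Base B → σ ℚ.* ℕ→ℚ ∣ A ∩ B ∣ ℚ.≤ b) → σ ℚ.* ℤ→ℚ (wtℤ A z) ℚ.≤ ℕ→ℚ t ℚ.* b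
    signed-≤ σ A {b} σA≤b = go z∈
      where
      σ·-out : ∀ (v : Fin n → ℚ) → sumℚ (λ i → σ ℚ.* ℕ→ℚ (χ A i) ℚ.* v i) ≡ σ ℚ.* sumℚ (λ i → ℕ→ℚ (χ A i) ℚ.* v i)
      σ·-out v = trans (sumℚ-cong (λ i → ℚₚ.*-assoc σ (ℕ→ℚ (χ A i)) (v i))) (sym (*-distribˡ-sum σ (λ i → ℕ→ℚ (χ A i) ℚ.* v i)))
      go : LatticePoint (dilate t (matroidPolytope M)) z → σ ℚ.* ℤ→ℚ (wtℤ A z) ℚ.≤ ℕ→ℚ t ℚ.* b
      go (y , (m , p , c , p∈ , 0≤c , ∑c≈1 , y≈) , z≈) = subst (ℚ._≤ ℕ→ℚ t ℚ.* b)
        (trans (σ·-out (λ i → ℤ→ℚ (lookup z i))) (cong (σ ℚ.*_) (dot-wtℤ A z)))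
        (convexCombination-≤ (λ i → σ ℚ.* ℕ→ℚ (χ A i)) (ℤ→ℚ-mono-≤ {+ 0} {+ t} (ℤ.+≤+ z≤n))
          (λ i → ℤ→ℚ (lookup z i)) (λ i → seq (y i)) (λ j → seq (c j)) (λ j i → seq (p j i)) (λ j i → ℕ→ℚ (χ (proj₁ (p∈ j)) i))
          (λ i → close (z≈ i))
          (λ i → ∼-trans (close (y≈ i)) (≗⇒∼ (seq-∑ (λ j → c j Defs.* p j i))))
          (λ j i → ∼-trans (close (proj₂ (proj₂ (p∈ j)) i)) (≗⇒∼ (seq-e (proj₁ (p∈ j)) i)))
          (λ j → cauchy (c j))
          (λ j → below (0≤c j))
          (∼-trans (∼-sym (≗⇒∼ (seq-∑ c))) (close ∑c≈1))
          (λ j → subst (ℚ._≤ b) (sym (trans (σ·-out (λ i → ℕ→ℚ (χ (proj₁ (p∈ j)) i))) (cong (σ ℚ.*_) (dot-∩ A (proj₁ (p∈ j))))))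
                   (σA≤b (proj₁ (proj₂ (p∈ j))))))

    wtℤ-≤ : ∀ A {b} → (∀ {B} → Base B → ∣ A ∩ B ∣ ≤ b) → wtℤ A z ℤ.≤ + (t * b)
    wtℤ-≤ A {b} A∩B≤b = ℤ→ℚ-cancel-≤ (subst₂ ℚ._≤_ (ℚₚ.*-identityˡ _) (sym (ℕ→ℚ-homo-* t b))
      (signed-≤ 1ℚ A (λ B → subst (ℚ._≤ ℕ→ℚ b) (sym (ℚₚ.*-identityˡ _)) (ℤ→ℚ-mono-≤ (ℤ.+≤+ (A∩B≤b B))))))

    wtℤ-≥ : ∀ A {b} → (∀ {B} → Base B → b ≤ ∣ A ∩ B ∣) → + (t * b) ℤ.≤ wtℤ A z
    wtℤ-≥ A {b} b≤A∩B = ℤ→ℚ-cancel-≤ (subst (ℚ._≤ ℤ→ℚ (wtℤ A z)) (sym (ℕ→ℚ-homo-* t b)) (0≤p-q⇒q≤p (subst (0ℚ ℚ.≤_)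
        (solve 3 (λ t b w → t :* (:- con 1ℚ :* b) :- (:- con 1ℚ :* w) := w :- t :* b) refl (ℕ→ℚ t) (ℕ→ℚ b) (ℤ→ℚ (wtℤ A z)))
        (p≤q⇒0≤q-p (signed-≤ (ℚ.- 1ℚ) A {(ℚ.- 1ℚ) ℚ.* ℕ→ℚ b} (λ B → ℚₚ.*-monoˡ-≤-nonPos (ℚ.- 1ℚ) (ℤ→ℚ-mono-≤ (ℤ.+≤+ (b≤A∩B B)))))))))
      where open ℚSolver.+-*-Solver

  sum-replicate : ∀ t (x : ℚ) → sumℚ {t} (λ _ → x) ≡ ℕ→ℚ t ℚ.* x
  sum-replicate zero    x = sym (ℚₚ.*-zeroˡ x)
  sum-replicate (suc t) x = trans (cong (x ℚ.+_) (sum-replicate t x))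
    (trans (cong (ℚ._+ ℕ→ℚ t ℚ.* x) (sym (ℚₚ.*-identityˡ x)))
    (trans (sym (ℚₚ.*-distribʳ-+ x 1ℚ (ℕ→ℚ t))) (cong (ℚ._* x) (sym (ℕ→ℚ-homo-+ 1 t)))))

  sum-ℕ→ℚ : ∀ {t} (f : Fin t → ℕ) → sumℚ (λ j → ℕ→ℚ (f j)) ≡ ℕ→ℚ (VF.foldr _+_ 0 f)
  sum-ℕ→ℚ {zero}  f = refl
  sum-ℕ→ℚ {suc t} f = trans (cong (ℕ→ℚ (f zero) ℚ.+_) (sum-ℕ→ℚ (f ∘ suc))) (sym (ℕ→ℚ-homo-+ (f zero) (VF.foldr _+_ 0 (f ∘ suc))))

  constant-≤ : ∀ {p q} → p ℚ.≤ q → ℚ→ℝ p Defs.≤ ℚ→ℝ q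
  constant-≤ {p} {q} p≤q ε 0<ε = 0 , λ _ → ℚₚ.≤-trans p≤q
    (subst (ℚ._≤ q ℚ.+ ε) (ℚₚ.+-identityʳ q) (ℚₚ.+-monoʳ-≤ q (ℚₚ.<⇒≤ 0<ε)))

  module _ {m} (B : Fin m → Subset n) (base : ∀ j → Base (B j)) (c : ℚ) where

    -- With c = 1/m this is the barycentre of the bases, and its m-th multiple is their sum. All
    -- coefficients are constant rationals, so the required equalities hold term by term in the
    -- sequences.
    average : ℝ^ n
    average i = ∑ (λ j → ℚ→ℝ c Defs.* e (B j) i)

    average∈polytope : 0ℚ ℚ.≤ c → ℕ→ℚ m ℚ.* c ≡ 1ℚ → matroidPolytope M average
    average∈polytope 0≤c mc≡1 =
      m , (λ j → e (B j)) , (λ _ → ℚ→ℝ c) , (λ j → B j , base j , λ i → ≗⇒≈ {e (B j) i} {e (B j) i} (λ _ → refl)) ,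
      (λ _ → constant-≤ 0≤c) ,
      ≗⇒≈ {∑ {m} (λ _ → ℚ→ℝ c)} {1ℝ} (λ k → trans (seq-∑ {m} (λ _ → ℚ→ℝ c) k) (trans (sum-replicate m c) mc≡1)) ,
      λ i → ≗⇒≈ {average i} {average i} (λ _ → refl)

    seq-average : ∀ i k → seq (average i) k ≡ c ℚ.* ℕ→ℚ (VF.foldr _+_ 0 (λ j → χ (B j) i))
    seq-average i k = trans (seq-∑ (λ j → ℚ→ℝ c Defs.* e (B j) i) k)
      (trans (sumℚ-cong (λ j → cong (c ℚ.*_) (seq-e (B j) i k)))
      (trans (sym (*-distribˡ-sum c (λ j → ℕ→ℚ (χ (B j) i)))) (cong (c ℚ.*_) (sum-ℕ→ℚ (λ j → χ (B j) i)))))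

  ∑bases∈dilate : ∀ t (z : Vec ℕ n) (B : Fin t → Subset n) → (∀ j → Base (B j)) →
    (∀ i → lookup z i ≡ VF.foldr _+_ 0 (λ j → χ (B j) i)) → LatticePoint (dilate t (matroidPolytope M)) (Vec.map ℤ.+_ z)
  -- An empty family has no average. For t = 0 any base serves as the point of the polytope that is
  -- scaled to the origin.
  ∑bases∈dilate zero z B base z≡ =
    y , average∈polytope {1} (λ _ → proj₁ nonempty) (λ _ → proj₂ nonempty) 1ℚ (ℚₚ.nonNegative⁻¹ 1ℚ) refl ,
    λ i → ≗⇒≈ {ℤ→ℝ (lookup (Vec.map ℤ.+_ z) i)} {ℤ→ℝ (+ 0) Defs.* y i}
      (λ k → trans (cong ℤ→ℚ (trans (Vecₚ.lookup-map i ℤ.+_ z) (cong ℤ.+_ (z≡ i)))) (sym (ℚₚ.*-zeroˡ (seq (y i) k))))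
    where
    y : ℝ^ n
    y = average {1} (λ _ → proj₁ nonempty) (λ _ → proj₂ nonempty) 1ℚ
  ∑bases∈dilate (suc t) z B base z≡ =
    y , average∈polytope B base c (ℚₚ.nonNegative⁻¹ c {{ℚₚ.normalize-nonNeg 1 (suc t)}}) t*c≡1 ,
    λ i → ≗⇒≈ {ℤ→ℝ (lookup (Vec.map ℤ.+_ z) i)} {ℤ→ℝ (+ suc t) Defs.* y i} (λ k → sym (begin
      ℕ→ℚ (suc t) ℚ.* seq (y i) k                ≡⟨ cong (ℕ→ℚ (suc t) ℚ.*_) (seq-average B base c i k) ⟩
      ℕ→ℚ (suc t) ℚ.* (c ℚ.* ℕ→ℚ (total i))      ≡⟨ ℚₚ.*-assoc (ℕ→ℚ (suc t)) c (ℕ→ℚ (total i)) ⟨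
      ℕ→ℚ (suc t) ℚ.* c ℚ.* ℕ→ℚ (total i)        ≡⟨ cong (ℚ._* ℕ→ℚ (total i)) t*c≡1 ⟩
      1ℚ ℚ.* ℕ→ℚ (total i)                       ≡⟨ ℚₚ.*-identityˡ (ℕ→ℚ (total i)) ⟩
      ℕ→ℚ (total i)                              ≡⟨ cong ℕ→ℚ (z≡ i) ⟨
      ℕ→ℚ (lookup z i)                           ≡⟨ cong ℤ→ℚ (Vecₚ.lookup-map i ℤ.+_ z) ⟨
      ℤ→ℚ (lookup (Vec.map ℤ.+_ z) i)              ∎))
    where
    open ≡-Reasoning
    c : ℚ
    c = + 1 ℚ./ suc t
    t*c≡1 : ℕ→ℚ (suc t) ℚ.* c ≡ 1ℚ
    t*c≡1 = trans (ℚₚ.*-comm (ℕ→ℚ (suc t)) c) (1/k*k≡1 (suc t))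
    y : ℝ^ n
    y = average B base c
    total : Fin n → ℕ
    total i = VF.foldr _+_ 0 (λ j → χ (B j) i)

-- Enumeration of the lattice points and the theorem

unique⇒lookup-injective : ∀ {A : Set} {xs : List A} → Unique xs → ∀ {i j} → List.lookup xs i ≡ List.lookup xs j → i ≡ j
unique⇒lookup-injective (x∉ ∷ u) {zero}  {zero}  _  = refl
unique⇒lookup-injective (x∉ ∷ u) {zero}  {suc j} eq = contradiction eq (All.lookup x∉ (∈ₚ.∈-lookup j))
unique⇒lookup-injective (x∉ ∷ u) {suc i} {zero}  eq = contradiction (sym eq) (All.lookup x∉ (∈ₚ.∈-lookup i))
unique⇒lookup-injective (x∉ ∷ u) {suc i} {suc j} eq = cong suc (unique⇒lookup-injective u eq)

map-+-injective : ∀ {n} {y z : Vec ℕ n} → Vec.map ℤ.+_ y ≡ Vec.map ℤ.+_ z → y ≡ z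
map-+-injective {y = []}    {[]}    _  = refl
map-+-injective {y = _ ∷ _} {_ ∷ _} eq = cong₂ _∷_ (ℤₚ.+-injective (Vecₚ.∷-injectiveˡ eq)) (map-+-injective (Vecₚ.∷-injectiveʳ eq))

nonNegative⇒map-+ : ∀ {n} (z : Vec ℤ n) → (∀ i → + 0 ℤ.≤ lookup z i) → Vec.map ℤ.+_ (Vec.map ℤ.∣_∣ z) ≡ z
nonNegative⇒map-+ []      0≤z = refl
nonNegative⇒map-+ (x ∷ z) 0≤z = cong₂ _∷_ (ℤₚ.0≤i⇒+∣i∣≡i (0≤z zero)) (nonNegative⇒map-+ z (0≤z ∘ suc))

theorem1p1 : (n : ℕ) (M : Matroid (⊤ {n})) → Connected M → rk M ≡ 2 →
    (s : ℕ) (H : Enumeration (IsHyperplane M) s) (a : Fin s → ℕ) →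
    (∀ i → a i ≡ ∣ Enumeration.element H i ∣) →
    s ≥ 3 ×
    IsEhrhartPolynomial (matroidPolytope M)
    (binom ((+ 2) t+ (+ n ℤ.- + 1)) (n ∸ 1) -ᵖ foldr _+ᵖ_ [] (map (λ i → P (a i) n) (allFin s)))
theorem1p1 n M conn rk≡2 s H a a≡ =
  3≤s conn , λ t → length (lightCompositions t) , enumeration t , evaluation t
  where
  open Rank2 M rk≡2
  open Loopless (connected⇒loopless conn)
  open Classes H
  open Enumeration H using (element; sound)
  open Partition element class ∈-element⁺ ∈-element⁻
  open Matroid M using (Base; nonempty)

  ∈-light⁺ : ∀ t {z} → wt ⊤ z ≡ t + t → (∀ i → wt (element i) z ≤ t) → z List.∈ lightCompositions t
  ∈-light⁺ t {z} total≡ light = ∈ₚ.∈-filter⁺ (light? t) (∈-compositions⁺ (t + t) z total≡) (All.tabulate (λ {i} _ → light i))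

  light⇒lattice : ∀ t {z} → z List.∈ lightCompositions t → LatticePoint (dilate t (matroidPolytope M)) (Vec.map ℤ.+_ z)
  light⇒lattice t {z} z∈ =
    let z∈comps , light = ∈ₚ.∈-filter⁻ (light? t) {xs = compositions n (t + t)} z∈
        d = decompose t z (∈-compositions⁻ n (t + t) z∈comps) (λ i → All.lookup light (∈ₚ.∈-allFin i))
        open Decomposition d
    in ∑bases∈dilate M t z (λ j → ⁅ p j ⁆ ∪ ⁅ q j ⁆) (λ j → class≢⇒⋈ (distinct j)) expand

  -- All conditions are checked at bases. A base has exactly 2 elements, which fixes the total from
  -- both sides; intersections with singletons are nonnegative in size; a base meets a hyperplane at
  -- most once, because the hyperplane has rank 1.
  lattice⇒light : ∀ t {z} → LatticePoint (dilate t (matroidPolytope M)) z → ∃[ z′ ] z′ List.∈ lightCompositions t × Vec.map ℤ.+_ z′ ≡ z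
  lattice⇒light t {z} z∈ = z′ , ∈-light⁺ t
    (ℤₚ.+-injective (trans (sym (wt′ ⊤)) (trans (ℤₚ.≤-antisym (wtℤ-≤ M z t z∈ ⊤ (≤-reflexive ∘ size)) (wtℤ-≥ M z t z∈ ⊤ (≤-reflexive ∘ sym ∘ size)))
      (cong ℤ.+_ (trans (*-comm t 2) (cong (λ m → t + m) (+-identityʳ t)))))))
    (λ i → ℤₚ.drop‿+≤+ (subst₂ ℤ._≤_ (wt′ (element i)) (cong ℤ.+_ (*-identityʳ t)) (wtℤ-≤ M z t z∈ (element i)
      (λ b → ≤-trans (∣A∩B∣≤rank M (element i) b) (≤-reflexive (rank-hyperplane (sound i))))))) ,
    z′≡
    where
    z′ = Vec.map ℤ.∣_∣ z
    z′≡ : Vec.map ℤ.+_ z′ ≡ z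
    z′≡ = nonNegative⇒map-+ z (λ i → subst₂ ℤ._≤_ (cong ℤ.+_ (*-zeroʳ t)) (wtℤ-⁅⁆ i z) (wtℤ-≥ M z t z∈ ⁅ i ⁆ (λ _ → z≤n)))
    wt′ : ∀ A → wtℤ A z ≡ + wt A z′
    wt′ A = trans (cong (wtℤ A) (sym z′≡)) (wtℤ-map A z′)
    size : ∀ {B} → Base B → ∣ ⊤ ∩ B ∣ ≡ 2
    size {B} b = trans (cong ∣_∣ (∩-identityˡ B)) (base⇒∣B∣≡2 b)

  enumeration : ∀ t → Enumeration (LatticePoint (dilate t (matroidPolytope M))) (length (lightCompositions t))
  enumeration t = record
    { element   = λ i → Vec.map ℤ.+_ (List.lookup (lightCompositions t) i)
    ; injective = λ eq → unique⇒lookup-injective (Uniqueₚ.filter⁺ (light? t) (compositions-unique n (t + t))) (map-+-injective eq)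
    ; sound     = λ i → light⇒lattice t (∈ₚ.∈-lookup i)
    ; complete  = λ z∈ → let z′ , z′∈ , eq = lattice⇒light t z∈
                         in Any.index z′∈ , trans (cong (λ v → Vec.map ℤ.+_ v) (sym (Anyₚ.lookup-index z′∈))) eq
    }

  evaluation : ∀ t → eval (binom ((+ 2) t+ (+ n ℤ.- + 1)) (n ∸ 1) -ᵖ foldr _+ᵖ_ [] (map (λ i → P (a i) n) (allFin s))) (ℕ→ℚ t)
    ≡ ℕ→ℚ (length (lightCompositions t))
  evaluation t = begin
    eval (total -ᵖ excesses) (ℕ→ℚ t)
      ≡⟨ eval--ᵖ total excesses (ℕ→ℚ t) ⟩
    eval total (ℕ→ℚ t) ℚ.- eval excesses (ℕ→ℚ t)
      ≡⟨ cong₂ ℚ._-_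
           -- A base has an element, so n ≥ 1 and the truncated n ∸ 1 is the true difference.
           (eval-simplex n t {{nonZeroIndex (proj₁ (base⇒∃⋈ (proj₂ nonempty)))}})
           (eval-sum (λ i → P (a i) n) heavies (ℕ→ℚ t) (All.universal (λ i → trans (cong (λ k → eval (P k n) (ℕ→ℚ t)) (a≡ i))
             (eval-P (element i) t (∣element∣<n i))) (allFin s))) ⟩
    ℕ→ℚ (comp n (t + t)) ℚ.- ℕ→ℚ (sum (map heavies (allFin s)))
      ≡⟨ cong (λ k → ℕ→ℚ k ℚ.- ℕ→ℚ (sum (map heavies (allFin s)))) (length-lightCompositions t) ⟨
    ℕ→ℚ (length (lightCompositions t) + sum (map heavies (allFin s))) ℚ.- ℕ→ℚ (sum (map heavies (allFin s)))
      ≡⟨ cong (ℚ._- ℕ→ℚ (sum (map heavies (allFin s)))) (ℕ→ℚ-homo-+ (length (lightCompositions t)) _) ⟩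
    (ℕ→ℚ (length (lightCompositions t)) ℚ.+ ℕ→ℚ (sum (map heavies (allFin s)))) ℚ.- ℕ→ℚ (sum (map heavies (allFin s)))
      ≡⟨ solve 2 (λ x y → (x :+ y) :- y := x) refl (ℕ→ℚ (length (lightCompositions t))) (ℕ→ℚ (sum (map heavies (allFin s)))) ⟩
    ℕ→ℚ (length (lightCompositions t)) ∎
    where
    open ≡-Reasoning
    open ℚSolver.+-*-Solver
    total excesses : ℚ[t]
    total = binom ((+ 2) t+ (+ n ℤ.- + 1)) (n ∸ 1)
    excesses = foldr _+ᵖ_ [] (map (λ i → P (a i) n) (allFin s))
    heavies : Fin s → ℕ
    heavies i = heavyCount (element i) t
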